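{- Let $n\ge1$. The map $\psi=(\text{B-code})^{ -1}\circ\text{A-code}\colon B_n\to B_n$ is a bijection, and for every $\sigma\in B_n$, $$inv_B(\sigma)=sor_B(\psi(\sigma)),\quad \mathrm{Lmap_B}\,\sigma=\mathrm{Lmap_B}\,\psi(\sigma),\quad \mathrm{Rmil_B}\,\sigma=\mathrm{Cyc_B}\,\psi(\sigma).$$ In particular, $inv_B(\sigma)=sor_B(\psi(\sigma))$ and $nmin_B(\sigma)=l_B'(\psi(\sigma))$.
   Context: $B_n$: bijections $\sigma$ of $\{\pm1,\ldots,\pm n\}$ with $\sigma(-i)=-\sigma(i)$, written $\sigma_1\cdots\sigma_n$, $\sigma_i=\sigma(i)$, with composition as product. $\mathrm{Leh}\,\sigma=(a_1,\ldots,a_n)$, $a_i=\mathrm{sign}(\sigma_i)|\{j\le i:|\sigma_j|\le|\sigma_i|\}|$; A-code $\sigma=\mathrm{Leh}(\sigma^{ -1})$. B-code $\sigma=(b_1,\ldots,b_n)$ with $b_i=\sigma^{ -k_i}(i)$, $k_i$ the least $k\ge1$ with $|\sigma^{ -k}(i)|\le i$. Both codes take values in $\mathrm{SE}^{\mathrm B}_n=\{(a_1,\ldots,a_n): a_i\in[-i,i]\setminus\{0\}\}$. $inv_B(\sigma)=|\{i<j:\sigma_i>\sigma_j\}|+|\{i\le j:-\sigma_i>\sigma_j\}|$. For a word $\omega$: $\mathrm{Lmap_B}\,\omega=\{i:\omega_i>|\omega_j|\ \forall j<i\}$, $\mathrm{Rmil_B}\,\omega=\{\omega_i:0<\omega_i<|\omega_j|\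 \forall j>i\}$. $\mathrm{Cyc_B}\,\sigma$: the set of minimal elements of those cycles $C$ of the permutation $i\mapsto|\sigma(i)|$ of $[n]$ for which $|\{i\in C:\sigma(i)<0\}|$ is even. $nmin_B(\sigma)=|\{i:\sigma_i>|\sigma_j|\text{ for some }j>i\}|+N(\sigma)$, with $N(\sigma)$ the number of negative entries. Reflections $T^B$: $(i,j)$ for $1\le i<j\le n$ (exchanging $i,j$ and $-i,-j$), $(-i,j)$ for $1\le i<j\le n$ (exchanging $-i,j$ and $i,-j$), and $(-j,j)$ for $1\le j\le n$ (exchanging $j,-j$). Each $\sigma$ factors uniquely as $(i_1,j_1)\cdots(i_m,j_m)$ with factors in $T^B$ and $0<j_1<\cdots<j_m\le n$, and $sor_B(\sigma)=\sum_r(j_r-i_r-\chi(i_r<0))$ where $\chi$ is the indicator. $l_B'(\sigma)$ is the minimal number of elements of $T^B$ with product $\sigma$. -}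

module Defs where

open import Data.Nat as ℕ using (ℕ; zero; suc; _≤_; _<_; _≡ᵇ_; _≤ᵇ_; _<ᵇ_; _∸_)
open import Data.Integer as ℤ using (ℤ; +_; -[1+_]; ∣_∣; -_)
open import Data.Bool using (Bool; true; false; if_then_else_; _∧_; _∨_; not)
open import Data.List using (List; []; _∷_; length; map; filterᵇ; upTo)
open import Data.Bool.ListAction using (all; any)
open import Data.Nat.ListAction using (sum)
open import Data.List.Relation.Unary.All using (All)
open import Data.List.Relation.Unary.Unique.Propositional using (Unique)
open import Data.List.Relation.Unary.Linked using (Linked)
open import Data.Product using (Σ; _×_)
open import Relation.Binary.PropositionalEquality using (_≡_)
open import Relation.Nullary using (¬_)
open import Relation.Nullary.Decidable using (⌊_⌋)

-- A word ω = ω₁ ⋯ ωₙ is a list of integers; positions are 1-indexed.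
Word : Set
Word = List ℤ

range1 : ℕ → List ℕ
range1 n = map suc (upTo n)

-- ω ! i = ωᵢ  (1-indexed; 0 outside the range)
infixl 10 _!_
_!_ : Word → ℕ → ℤ
[]      ! _           = + 0
(x ∷ w) ! zero        = + 0
(x ∷ w) ! suc zero    = x
(x ∷ w) ! suc (suc k) = w ! suc k

infix 4 _<ᶻ_ _==ᶻ_
_<ᶻ_ : ℤ → ℤ → Bool
x <ᶻ y = ⌊ x ℤ.<? y ⌋

_==ᶻ_ : ℤ → ℤ → Bool
x ==ᶻ y = ⌊ x ℤ.≟ y ⌋

isNeg : ℤ → Bool
isNeg x = x <ᶻ + 0

count : {A : Set} → (A → Bool) → List A → ℕ
count p xs = length (filterᵇ p xs)

-- σ ∈ Bₙ is represented by its window σ₁ ⋯ σₙ (σᵢ = σ(i)); σ(-i) = -σ(i).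
-- The word is the window of an element of Bₙ iff it has length n, every
-- |σᵢ| lies in [1,n], and the |σᵢ| are pairwise distinct.
IsB : ℕ → Word → Set
IsB n w = length w ≡ n × All (λ x → 1 ≤ ∣ x ∣ × ∣ x ∣ ≤ n) w × Unique (map ∣_∣ w)

IsSE : ℕ → Word → Set
IsSE n c = length c ≡ n × (∀ i → 1 ≤ i → i ≤ n → ¬ (c ! i ≡ + 0) × ∣ c ! i ∣ ≤ i)

app : Word → ℤ → ℤ
app w (+ zero)    = + 0
app w (+ suc k)   = w ! suc k
app w -[1+ k ]    = - (w ! suc k)

pre : Word → ℕ → ℤ
pre w i = go 1 w
  where
  go : ℕ → Word → ℤ
  go p []       = + 0
  go p (x ∷ xs) = if x ==ᶻ (+ i) then + p
                  else if x ==ᶻ (- (+ i)) then - (+ p)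
                  else go (suc p) xs

appInv : Word → ℤ → ℤ
appInv w (+ k)     = pre w k
appInv w -[1+ k ]  = - pre w (suc k)

invWord : Word → Word
invWord w = map (pre w) (range1 (length w))

signed : ℤ → ℕ → ℤ
signed x c = if isNeg x then - (+ c) else + c

Leh : Word → Word
Leh w = map (λ i → signed (w ! i)
                     (count (λ j → ∣ w ! j ∣ ℕ.≤ᵇ ∣ w ! i ∣) (range1 i)))
            (range1 (length w))

Acode : Word → Word
Acode w = Leh (invWord w)

-- bstep f w i y : starting from y = i, apply σ⁻¹ until the absolute value
-- is ≤ i and return that value σ^{-kᵢ}(i).  The fuel f = n suffices:
-- kᵢ is at most the length (≤ n) of the cycle of |σ| containing i.
bstep : ℕ → Word → ℕ → ℤ → ℤ
bstep zero    w i y = + 0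
bstep (suc f) w i y =
  if ∣ appInv w y ∣ ℕ.≤ᵇ i then appInv w y else bstep f w i (appInv w y)

-- B-code σ = (b₁,…,bₙ), bᵢ = σ^{-kᵢ}(i), kᵢ least k ≥ 1 with |σ^{-k}(i)| ≤ i
Bcode : Word → Word
Bcode w = map (λ i → bstep (length w) w i (+ i)) (range1 (length w))

invB : Word → ℕ
invB w = sum (map (λ i → count (λ j → (i ℕ.<ᵇ j) ∧ (w ! j <ᶻ w ! i)) ns
                       ℕ.+ count (λ j → (i ℕ.≤ᵇ j) ∧ (w ! j <ᶻ (- (w ! i)))) ns) ns)
  where ns = range1 (length w)

Lmap : Word → List ℕ
Lmap w = filterᵇ (λ i → all (λ j → (+ ∣ w ! j ∣) <ᶻ (w ! i)) (range1 (i ∸ 1)))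
                 (range1 (length w))

isRmil : Word → ℕ → Bool
isRmil w v = any (λ i → (w ! i ==ᶻ + v) ∧ (+ 0 <ᶻ w ! i)
                      ∧ all (λ j → not (i ℕ.<ᵇ j) ∨ (w ! i <ᶻ + ∣ w ! j ∣)) ns) ns
  where ns = range1 (length w)

Rmil : Word → List ℕ
Rmil w = filterᵇ (isRmil w) (range1 (length w))

absPerm : Word → ℕ → ℕ
absPerm w i = ∣ w ! i ∣

-- orbit f w s x = x, π x, π² x, … up to (excluding) the first return to s
-- (fuel f = n suffices, cycles have length ≤ n)
orbit : ℕ → Word → ℕ → ℕ → List ℕ
orbit zero    w s x = []
orbit (suc f) w s x = if x ℕ.≡ᵇ s then [] else x ∷ orbit f w s (absPerm w x)

cycleOf : Word → ℕ → List ℕ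
cycleOf w m = m ∷ orbit (length w) w m (absPerm w m)

even : ℕ → Bool
even zero          = true
even (suc zero)    = false
even (suc (suc k)) = even k

isCycMin : Word → ℕ → Bool
isCycMin w m = all (λ x → m ℕ.≤ᵇ x) (cycleOf w m)
             ∧ even (count (λ x → isNeg (w ! x)) (cycleOf w m))

CycB : Word → List ℕ
CycB w = filterᵇ (isCycMin w) (range1 (length w))

nmin : Word → ℕ
nmin w = count (λ i → any (λ j → (i ℕ.<ᵇ j) ∧ ((+ ∣ w ! j ∣) <ᶻ w ! i)) ns) ns
       ℕ.+ count isNeg w
  where ns = range1 (length w)

data Refl : Set where
  tr  : ℕ → ℕ → Refl   -- (i,j)   : i ↔ j, -i ↔ -j
  ntr : ℕ → ℕ → Refl   -- (-i,j)  : -i ↔ j, i ↔ -j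
  fl  : ℕ → Refl       -- (-j,j)  : j ↔ -j

ValidRefl : ℕ → Refl → Set
ValidRefl n (tr i j)  = 1 ≤ i × i < j × j ≤ n
ValidRefl n (ntr i j) = 1 ≤ i × i < j × j ≤ n
ValidRefl n (fl j)    = 1 ≤ j × j ≤ n

swap : ℤ → ℤ → ℤ → ℤ
swap a b x = if x ==ᶻ a then b else if x ==ᶻ b then a
             else if x ==ᶻ (- a) then - b else if x ==ᶻ (- b) then - a else x

applyRefl : Refl → ℤ → ℤ
applyRefl (tr i j)  = swap (+ i) (+ j)
applyRefl (ntr i j) = swap (- (+ i)) (+ j)
applyRefl (fl j)    x = if x ==ᶻ (+ j) then - (+ j) else if x ==ᶻ (- (+ j)) then + j else x

prodApply : List Refl → ℤ → ℤ
prodApply []       x = x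
prodApply (t ∷ ts) x = applyRefl t (prodApply ts x)

IsProduct : ℕ → List Refl → Word → Set
IsProduct n ts w = All (ValidRefl n) ts
                 × (∀ i → 1 ≤ i → i ≤ n → prodApply ts (+ i) ≡ w ! i)

jOf : Refl → ℕ
jOf (tr _ j)  = j
jOf (ntr _ j) = j
jOf (fl j)    = j

-- j_r − i_r − χ(i_r < 0) with i_r the signed first entry
weight : Refl → ℕ
weight (tr i j)  = j ∸ i
weight (ntr i j) = j ℕ.+ i ∸ 1
weight (fl j)    = j ℕ.+ j ∸ 1

IsIncFact : ℕ → List Refl → Word → Set
IsIncFact n ts w = IsProduct n ts w × Linked _<_ (map jOf ts)

IsSorB : ℕ → Word → ℕ → Set
IsSorB n w s = Σ (List Refl) (λ ts → IsIncFact n ts w × sum (map weight ts) ≡ s)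
             × (∀ ts → IsIncFact n ts w → sum (map weight ts) ≡ s)

IsReflLength : ℕ → Word → ℕ → Set
IsReflLength n w m = Σ (List Refl) (λ ts → IsProduct n ts w × length ts ≡ m)
                   × (∀ ts → IsProduct n ts w → m ≤ length ts)

{-# OPTIONS --safe #-}
module Submission where

-- Both codes are inverted one letter at a time, so that σ and ψ(σ) are grown from the same
-- sequence x₁ ⋯ xₙ.  Inverting the A-code, step N inserts ±N, with the sign of x, at position |x|
-- of the window.  Inverting the B-code, step N multiplies on the right by the reflection
-- exchanging x and N (the identity if x = N), which inserts N after |x| in the cycles of |σ|.
-- Each statistic changes in the same way under both steps: inv and sor grow by the weight of the
-- reflection (x,N); Lmap loses what lies to the right of |x| and may gain |x|; Rmil and Cyc gain
-- N exactly when x = N, because otherwise the lengthened cycle keeps the parity of its number of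
-- negative letters; and nmin counts the steps with x ≠ N.  That this number is the reflection
-- length follows by pushing the reflections that move N to the right of a factorization and
-- merging them, since (a,N)(b,N) = s(c,N) for a reflection s fixing N.

-- Every signed permutation is `α c` for some code `c`, and also `φ d` for some code `d`, so every
-- claim reduces to comparing the two words attached to one code. The A-code of `α c` is `c` because
-- later insertions never change the relative order of the positions of smaller letters. The B-code
-- of `φ c` is `c` because later reflections only put letters larger than `i` on the way from `i`
-- back to `[-i,i]`, and the B-code passes over those. The second fact does double duty: it makes
-- the code a complete invariant of the permutation. Any factorization of `φ c`, once rewritten as a
-- product along some code, must therefore be along `c` itself. This gives the independence of the
-- sorting index from the chosen increasing factorization, when the rewriting keeps the total
-- weight, and the lower bound for the reflection length, when it does not lengthen the
-- factorization. The recurring obstacle is that `bstep` and `orbit` run on fuel; the relation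
-- `Path` describes the same iterations without fuel, and its lists are free of repetition, hence
-- short enough.

open import Defs
open import Data.Bool using (Bool; true; false; if_then_else_; _∧_; _∨_; not; T; _xor_)
open import Data.Bool.ListAction using (and; or; all; any)
open import Data.Bool.Properties using (xor-assoc)
open import Data.Integer as ℤ using (ℤ; +_; -[1+_]; ∣_∣; -_)
import Data.Integer.Properties as ℤ
open import Data.List using (List; []; _∷_; _++_; _∷ʳ_; length; map; filterᵇ; upTo)
open import Data.List.Membership.Propositional using (_∈_)
open import Data.List.Membership.Propositional.Properties
  using (∈-∃++; ∈-++⁺ˡ; ∈-++⁺ʳ; ∈-++⁻; ∈-map⁻)
open import Data.List.Properties
  using (length-map; length-++; length-upTo; map-∘; map-++; map-upTo; upTo-∷ʳ; map-cong-local; ∷ʳ-injective)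
open import Data.List.Relation.Binary.Permutation.Propositional
  using (_↭_; ↭⇒↭ₛ; ↭-refl; ↭-trans; ↭-sym; prep)
  renaming (swap to ↭-swap)
import Data.List.Relation.Binary.Permutation.Propositional.Properties as ↭
import Data.List.Relation.Binary.Permutation.Setoid.Properties as ↭ₛ
open import Data.List.Relation.Unary.All as All using (All; []; _∷_)
import Data.List.Relation.Unary.All.Properties as All
open import Data.List.Relation.Unary.AllPairs using (AllPairs; []; _∷_)
import Data.List.Relation.Unary.AllPairs.Properties as AllPairs
open import Data.List.Relation.Unary.Any using (here; there)
open import Data.List.Relation.Unary.Linked.Properties using (AllPairs⇒Linked; Linked⇒AllPairs)
open import Data.List.Relation.Unary.Unique.Propositional using (Unique)
import Data.List.Relation.Unary.Unique.Propositional.Properties as Unique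
open import Data.List.Reverse using (Reverse; reverseView; []; _∶_∶ʳ_)
open import Data.Nat as ℕ using (ℕ; zero; suc; _≤_; _<_; z≤n; s≤s; _∸_)
import Data.Nat.Properties as ℕ
open import Data.List.Membership.DecPropositional ℕ._≟_ using (_∈?_)
open import Data.Nat.ListAction using (sum)
open import Data.Nat.ListAction.Properties using (sum-++)
open import Data.Nat.Tactic.RingSolver using (solve-∀)
open import Data.Product using (Σ; ∃; _×_; _,_; proj₁; proj₂)
open import Data.Sum using (_⊎_; inj₁; inj₂; [_,_]′)
open import Data.Unit using (tt)
open import Function using (_∘_; id; case_of_)
open import Relation.Binary.Definitions using (Tri; tri<; tri≈; tri>)
open import Relation.Binary.PropositionalEquality
open import Relation.Nullary using (¬_; Dec; yes; no; contradiction)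
open import Relation.Nullary.Decidable using (⌊_⌋; toWitness)

-- Booleans, counting and words

T-ext : ∀ {a b} → (T a → T b) → (T b → T a) → a ≡ b
T-ext {false} {false} f g = refl
T-ext {false} {true}  f g = contradiction (g tt) id
T-ext {true}  {false} f g = contradiction (f tt) id
T-ext {true}  {true}  f g = refl

T⇒≡ : ∀ {b} → T b → b ≡ true
T⇒≡ {true} _ = refl

¬T⇒≡ : ∀ {b} → ¬ T b → b ≡ false
¬T⇒≡ {true}  h = contradiction tt h
¬T⇒≡ {false} _ = refl

isYes-true : ∀ {A : Set} (d : Dec A) → A → ⌊ d ⌋ ≡ true
isYes-true (yes _) _ = refl
isYes-true (no ¬a) a = contradiction a ¬a

isYes-false : ∀ {A : Set} (d : Dec A) → ¬ A → ⌊ d ⌋ ≡ false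
isYes-false (yes a) ¬a = contradiction a ¬a
isYes-false (no _)  _  = refl

isYes-cong : ∀ {A B : Set} (d : Dec A) (e : Dec B) → (A → B) → (B → A) → ⌊ d ⌋ ≡ ⌊ e ⌋
isYes-cong (yes a) e f g = sym (isYes-true e (f a))
isYes-cong (no ¬a) e f g = sym (isYes-false e (¬a ∘ g))

≤ᵇ-true : ∀ {m n} → m ≤ n → (m ℕ.≤ᵇ n) ≡ true
≤ᵇ-true = T⇒≡ ∘ ℕ.≤⇒≤ᵇ

≤ᵇ-false : ∀ {m n} → n < m → (m ℕ.≤ᵇ n) ≡ false
≤ᵇ-false n<m = ¬T⇒≡ (λ t → ℕ.<⇒≱ n<m (ℕ.≤ᵇ⇒≤ _ _ t))

≡ᵇ-true : ∀ {m n} → m ≡ n → (m ℕ.≡ᵇ n) ≡ true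
≡ᵇ-true = T⇒≡ ∘ ℕ.≡⇒≡ᵇ _ _

≡ᵇ-false : ∀ {m n} → m ≢ n → (m ℕ.≡ᵇ n) ≡ false
≡ᵇ-false m≢n = ¬T⇒≡ (m≢n ∘ ℕ.≡ᵇ⇒≡ _ _)

Range : ℕ → ℕ → Set
Range n i = 1 ≤ i × i ≤ n

Range-suc : ∀ {n i} → Range n i → Range (suc n) i
Range-suc (p , q) = p , ℕ.m≤n⇒m≤1+n q

range1-suc : ∀ n → range1 (suc n) ≡ 1 ∷ map suc (range1 n)
range1-suc n = cong (λ l → 1 ∷ map suc l) (sym (map-upTo suc n))

range1-∷ʳ : ∀ n → range1 (suc n) ≡ range1 n ∷ʳ suc n
range1-∷ʳ n = trans (cong (map suc) (sym (upTo-∷ʳ n))) (map-++ suc (upTo n) (n ∷ []))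

length-range1 : ∀ n → length (range1 n) ≡ n
length-range1 n = trans (length-map suc (upTo n)) (length-upTo n)

All-range1 : ∀ n → All (Range n) (range1 n)
All-range1 zero    = []
All-range1 (suc n) = subst (All _) (sym (range1-suc n)) (
  (ℕ.≤-refl , s≤s z≤n) ∷ All.map⁺ (All.map (λ (p , q) → s≤s z≤n , s≤s q) (All-range1 n)))

range1-map-cong : ∀ {A : Set} n {f g : ℕ → A} → (∀ i → Range n i → f i ≡ g i) →
                  map f (range1 n) ≡ map g (range1 n)
range1-map-cong n h = map-cong-local (All.map (h _) (All-range1 n))

filterᵇ-cong : ∀ {A : Set} {p q : A → Bool} {xs} → All (λ x → p x ≡ q x) xs →
               filterᵇ p xs ≡ filterᵇ q xs
filterᵇ-cong [] = refl
filterᵇ-cong {q = q} {x ∷ xs} (e ∷ es) rewrite e with q x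
... | true  = cong (x ∷_) (filterᵇ-cong es)
... | false = filterᵇ-cong es

count-cong : ∀ {A : Set} {p q : A → Bool} {xs} → All (λ x → p x ≡ q x) xs → count p xs ≡ count q xs
count-cong h = cong length (filterᵇ-cong h)

all-cong : ∀ {A : Set} {p q : A → Bool} {xs} → All (λ x → p x ≡ q x) xs → all p xs ≡ all q xs
all-cong []       = refl
all-cong (e ∷ es) = cong₂ _∧_ e (all-cong es)

any-cong : ∀ {A : Set} {p q : A → Bool} {xs} → All (λ x → p x ≡ q x) xs → any p xs ≡ any q xs
any-cong []       = refl
any-cong (e ∷ es) = cong₂ _∨_ e (any-cong es)

all-map : ∀ {A B : Set} (p : B → Bool) (f : A → B) xs → all p (map f xs) ≡ all (p ∘ f) xs
all-map p f xs = cong and (sym (map-∘ xs))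

any-map : ∀ {A B : Set} (p : B → Bool) (f : A → B) xs → any p (map f xs) ≡ any (p ∘ f) xs
any-map p f xs = cong or (sym (map-∘ xs))

𝟙 : Bool → ℕ
𝟙 b = if b then 1 else 0

count-∷ : ∀ {A : Set} (p : A → Bool) x xs → count p (x ∷ xs) ≡ 𝟙 (p x) ℕ.+ count p xs
count-∷ p x xs with p x
... | true  = refl
... | false = refl

count-map : ∀ {A B : Set} (p : B → Bool) (f : A → B) xs → count p (map f xs) ≡ count (p ∘ f) xs
count-map p f []       = refl
count-map p f (x ∷ xs) = begin
  count p (f x ∷ map f xs)               ≡⟨ count-∷ p (f x) (map f xs) ⟩
  𝟙 (p (f x)) ℕ.+ count p (map f xs)     ≡⟨ cong (𝟙 (p (f x)) ℕ.+_) (count-map p f xs) ⟩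
  𝟙 (p (f x)) ℕ.+ count (p ∘ f) xs       ≡⟨ count-∷ (p ∘ f) x xs ⟨
  count (p ∘ f) (x ∷ xs)                 ∎
  where open ≡-Reasoning

count-++ : ∀ {A : Set} (p : A → Bool) xs ys → count p (xs ++ ys) ≡ count p xs ℕ.+ count p ys
count-++ p []       ys = refl
count-++ p (x ∷ xs) ys = begin
  count p (x ∷ xs ++ ys)                             ≡⟨ count-∷ p x (xs ++ ys) ⟩
  𝟙 (p x) ℕ.+ count p (xs ++ ys)                     ≡⟨ cong (𝟙 (p x) ℕ.+_) (count-++ p xs ys) ⟩
  𝟙 (p x) ℕ.+ (count p xs ℕ.+ count p ys)            ≡⟨ ℕ.+-assoc (𝟙 (p x)) _ _ ⟨
  𝟙 (p x) ℕ.+ count p xs ℕ.+ count p ys              ≡⟨ cong (ℕ._+ count p ys) (count-∷ p x xs) ⟨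
  count p (x ∷ xs) ℕ.+ count p ys                    ∎
  where open ≡-Reasoning

count-range1-suc : ∀ (p : ℕ → Bool) n → count p (range1 (suc n)) ≡ count p (range1 n) ℕ.+ 𝟙 (p (suc n))
count-range1-suc p n = begin
  count p (range1 (suc n))                       ≡⟨ cong (count p) (range1-∷ʳ n) ⟩
  count p (range1 n ∷ʳ suc n)                    ≡⟨ count-++ p (range1 n) _ ⟩
  count p (range1 n) ℕ.+ count p (suc n ∷ [])    ≡⟨ cong (count p (range1 n) ℕ.+_) (trans (count-∷ p (suc n) []) (ℕ.+-identityʳ _)) ⟩
  count p (range1 n) ℕ.+ 𝟙 (p (suc n))           ∎
  where open ≡-Reasoning

count-false : ∀ {A : Set} {p : A → Bool} {xs} → All (λ x → p x ≡ false) xs → count p xs ≡ 0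
count-false []                          = refl
count-false {p = p} {x ∷ xs} (e ∷ es)   = trans (count-∷ p x xs) (cong₂ ℕ._+_ (cong 𝟙 e) (count-false es))

count-true : ∀ {A : Set} {p : A → Bool} {xs} → All (λ x → p x ≡ true) xs → count p xs ≡ length xs
count-true []                          = refl
count-true {p = p} {x ∷ xs} (e ∷ es)   = trans (count-∷ p x xs) (cong₂ ℕ._+_ (cong 𝟙 e) (count-true es))

!-suc : ∀ x w i → 1 ≤ i → (x ∷ w) ! suc i ≡ w ! i
!-suc x w (suc i) _ = refl

map-range1-! : ∀ {n} (f : ℕ → ℤ) i → Range n i → map f (range1 n) ! i ≡ f i
map-range1-! {suc n} f (suc zero)    _       = refl
map-range1-! {suc n} f (suc (suc i)) (_ , s≤s q) = begin
  map f (range1 (suc n)) ! suc (suc i)          ≡⟨ cong (λ l → map f l ! suc (suc i)) (range1-suc n) ⟩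
  map f (map suc (range1 n)) ! suc i            ≡⟨ cong (_! suc i) (map-∘ (range1 n)) ⟨
  map (f ∘ suc) (range1 n) ! suc i              ≡⟨ map-range1-! (f ∘ suc) (suc i) (s≤s z≤n , q) ⟩
  f (suc (suc i))                               ∎
  where open ≡-Reasoning

map-!-range1 : ∀ w → map (w !_) (range1 (length w)) ≡ w
map-!-range1 []      = refl
map-!-range1 (x ∷ w) = trans (cong (map ((x ∷ w) !_)) (range1-suc (length w))) (cong (x ∷_) (begin
  map ((x ∷ w) !_) (map suc (range1 (length w)))  ≡⟨ map-∘ (range1 (length w)) ⟨
  map (λ i → (x ∷ w) ! suc i) (range1 (length w)) ≡⟨ range1-map-cong (length w) (λ i r → !-suc x w i (proj₁ r)) ⟩
  map (w !_) (range1 (length w))                  ≡⟨ map-!-range1 w ⟩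
  w                                               ∎))
  where open ≡-Reasoning

word-ext : ∀ {n} v w → length v ≡ n → length w ≡ n → (∀ i → Range n i → v ! i ≡ w ! i) → v ≡ w
word-ext v w refl e h = begin
  v                              ≡⟨ map-!-range1 v ⟨
  map (v !_) (range1 (length v)) ≡⟨ range1-map-cong _ h ⟩
  map (w !_) (range1 (length v)) ≡⟨ cong (map (w !_) ∘ range1) e ⟨
  map (w !_) (range1 (length w)) ≡⟨ map-!-range1 w ⟩
  w                              ∎
  where open ≡-Reasoning

!-All : ∀ {P : ℤ → Set} {w} → All P w → ∀ i → Range (length w) i → P (w ! i)
!-All (p ∷ ps) (suc zero)    _           = p
!-All (p ∷ ps) (suc (suc i)) (_ , s≤s q) = !-All ps (suc i) (s≤s z≤n , q)

!-∈ : ∀ {w} i → Range (length w) i → w ! i ∈ w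
!-∈ {x ∷ w} (suc zero)    _           = here refl
!-∈ {x ∷ w} (suc (suc i)) (_ , s≤s q) = there (!-∈ (suc i) (s≤s z≤n , q))

∈-split : ∀ {A : Set} {x z : A} us {vs} → z ∈ us ++ x ∷ vs → z ≢ x → z ∈ us ++ vs
∈-split us z∈ z≢x with ∈-++⁻ us z∈
... | inj₁ p           = ∈-++⁺ˡ p
... | inj₂ (here z≡x)  = contradiction z≡x z≢x
... | inj₂ (there p)   = ∈-++⁺ʳ us p

Unique-⊆-length : ∀ {A : Set} {xs ys : List A} → Unique xs → All (_∈ ys) xs → length xs ≤ length ys
Unique-⊆-length []        []       = z≤n
Unique-⊆-length {ys = ys} (x∉ ∷ u) (x∈ys ∷ xs⊆ys) with us , vs , refl ← ∈-∃++ x∈ys =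
  ℕ.≤-trans (s≤s (Unique-⊆-length u (All.zipWith (λ (z∈ , z≢) → ∈-split us z∈ (z≢ ∘ sym)) (xs⊆ys , x∉))))
    (ℕ.≤-reflexive (trans (cong suc (length-++ us)) (sym (trans (length-++ us) (ℕ.+-suc _ _)))))

∈-range1 : ∀ {n i} → Range n i → i ∈ range1 n
∈-range1 {zero}  (s≤s _ , ())
∈-range1 {suc n} {i} (p , q) rewrite range1-∷ʳ n with ℕ.m≤n⇒m<n∨m≡n q
... | inj₁ (s≤s i≤n) = ∈-++⁺ˡ (∈-range1 (p , i≤n))
... | inj₂ refl      = ∈-++⁺ʳ (range1 n) (here refl)

-- Pigeonhole on `[1,n]`. It bounds the length of repetition-free paths, hence the fuel of `bstep`
-- and `orbit`, and it turns injectivity into surjectivity.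
Unique-length≤ : ∀ {n xs} → Unique xs → All (Range n) xs → length xs ≤ n
Unique-length≤ {n} u r =
  subst (_ ≤_) (length-range1 n) (Unique-⊆-length u (All.map ∈-range1 r))

-- Swaps and codes

InR : ℕ → ℤ → Set
InR n z = Range n ∣ z ∣

∣∣-cases : ∀ x y → ∣ x ∣ ≡ ∣ y ∣ → x ≡ y ⊎ x ≡ - y
∣∣-cases (+ m)      (+ n)       e    = inj₁ (cong +_ e)
∣∣-cases (+ suc m)  -[1+ n ]    refl = inj₂ refl
∣∣-cases -[1+ m ]   (+ suc n)   refl = inj₂ refl
∣∣-cases -[1+ m ]   -[1+ n ]    refl = inj₁ refl

x≢-x : ∀ {x} → 1 ≤ ∣ x ∣ → x ≢ - x
x≢-x {+ zero}   ()
x≢-x {+ suc n}  _ ()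
x≢-x { -[1+ n ]} _ ()

-≡⇒≡- : ∀ {x y} → - x ≡ y → x ≡ - y
-≡⇒≡- {x} e = trans (sym (ℤ.neg-involutive x)) (cong -_ e)

-- The cases overlap when `∣ a ∣ ≡ ∣ b ∣`, as for the reflection `(-N,N)`. This is harmless: the
-- evaluation lemmas below hold for nonzero endpoints whichever of the four tests in `swap` succeeds
-- first.
data SwapView (a b x : ℤ) : Set where
  is-a  : x ≡ a → SwapView a b x
  is-b  : x ≡ b → SwapView a b x
  is--a : x ≡ - a → SwapView a b x
  is--b : x ≡ - b → SwapView a b x
  other : ∣ x ∣ ≢ ∣ a ∣ → ∣ x ∣ ≢ ∣ b ∣ → SwapView a b x

swapView : ∀ a b x → SwapView a b x
swapView a b x with ∣ x ∣ ℕ.≟ ∣ a ∣ | ∣ x ∣ ℕ.≟ ∣ b ∣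
... | yes p | _     = [ is-a , is--a ]′ (∣∣-cases x a p)
... | no _  | yes q = [ is-b , is--b ]′ (∣∣-cases x b q)
... | no p  | no q  = other p q

swap-fst : ∀ a b → swap a b a ≡ b
swap-fst a b rewrite isYes-true (a ℤ.≟ a) refl = refl

swap-snd : ∀ a b → swap a b b ≡ a
swap-snd a b with b ℤ.≟ a
... | yes e = e
... | no _  rewrite isYes-true (b ℤ.≟ b) refl = refl

swap-other : ∀ a b x → ∣ x ∣ ≢ ∣ a ∣ → ∣ x ∣ ≢ ∣ b ∣ → swap a b x ≡ x
swap-other a b x p q
  rewrite isYes-false (x ℤ.≟ a) (p ∘ cong ∣_∣)
        | isYes-false (x ℤ.≟ b) (q ∘ cong ∣_∣)
        | isYes-false (x ℤ.≟ - a) (λ e → p (trans (cong ∣_∣ e) (ℤ.∣-i∣≡∣i∣ a)))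
        | isYes-false (x ℤ.≟ - b) (λ e → q (trans (cong ∣_∣ e) (ℤ.∣-i∣≡∣i∣ b))) = refl

swap-neg-fst : ∀ a b → 1 ≤ ∣ a ∣ → swap a b (- a) ≡ - b
swap-neg-fst a b nz rewrite isYes-false (- a ℤ.≟ a) (x≢-x nz ∘ sym) with - a ℤ.≟ b
... | yes e = -≡⇒≡- e
... | no _ rewrite isYes-true (- a ℤ.≟ - a) refl = refl

swap-neg-snd : ∀ a b → 1 ≤ ∣ b ∣ → swap a b (- b) ≡ - a
swap-neg-snd a b nz with - b ℤ.≟ a
... | yes e = -≡⇒≡- e
... | no _ rewrite isYes-false (- b ℤ.≟ b) (x≢-x nz ∘ sym) with - b ℤ.≟ - a
...   | yes e = e
...   | no _ rewrite isYes-true (- b ℤ.≟ - b) refl = refl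

module _ (a b : ℤ) (nza : 1 ≤ ∣ a ∣) (nzb : 1 ≤ ∣ b ∣) where

  swap-odd : ∀ x → swap a b (- x) ≡ - swap a b x
  swap-odd x with swapView a b x
  ... | is-a refl  = trans (swap-neg-fst a b nza) (cong -_ (sym (swap-fst a b)))
  ... | is-b refl  = trans (swap-neg-snd a b nzb) (cong -_ (sym (swap-snd a b)))
  ... | is--a refl = begin
      swap a b (- - a)    ≡⟨ cong (swap a b) (ℤ.neg-involutive a) ⟩
      swap a b a          ≡⟨ swap-fst a b ⟩
      b                   ≡⟨ ℤ.neg-involutive b ⟨
      - - b               ≡⟨ cong -_ (swap-neg-fst a b nza) ⟨
      - swap a b (- a)    ∎
      where open ≡-Reasoning
  ... | is--b refl = begin
      swap a b (- - b)    ≡⟨ cong (swap a b) (ℤ.neg-involutive b) ⟩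
      swap a b b          ≡⟨ swap-snd a b ⟩
      a                   ≡⟨ ℤ.neg-involutive a ⟨
      - - a               ≡⟨ cong -_ (swap-neg-snd a b nzb) ⟨
      - swap a b (- b)    ∎
      where open ≡-Reasoning
  ... | other p q = trans (swap-other a b (- x) (p ∘ trans (sym (ℤ.∣-i∣≡∣i∣ x))) (q ∘ trans (sym (ℤ.∣-i∣≡∣i∣ x))))
                          (cong -_ (sym (swap-other a b x p q)))

  swap-involutive : ∀ x → swap a b (swap a b x) ≡ x
  swap-involutive x with swapView a b x
  ... | is-a refl  = trans (cong (swap a b) (swap-fst a b)) (swap-snd a b)
  ... | is-b refl  = trans (cong (swap a b) (swap-snd a b)) (swap-fst a b)
  ... | is--a refl = trans (cong (swap a b) (swap-neg-fst a b nza)) (swap-neg-snd a b nzb)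
  ... | is--b refl = trans (cong (swap a b) (swap-neg-snd a b nzb)) (swap-neg-fst a b nza)
  ... | other p q  = trans (cong (swap a b) (swap-other a b x p q)) (swap-other a b x p q)

  swap-injective : ∀ x y → swap a b x ≡ swap a b y → x ≡ y
  swap-injective x y e =
    trans (sym (swap-involutive x)) (trans (cong (swap a b) e) (swap-involutive y))

  swap-preserves : (P : ℕ → Set) → P ∣ a ∣ → P ∣ b ∣ → ∀ x → P ∣ x ∣ → P ∣ swap a b x ∣
  swap-preserves P pa pb x px with swapView a b x
  ... | is-a refl  = subst P (cong ∣_∣ (sym (swap-fst a b))) pb
  ... | is-b refl  = subst P (cong ∣_∣ (sym (swap-snd a b))) pa
  ... | is--a refl = subst P (trans (sym (ℤ.∣-i∣≡∣i∣ b)) (cong ∣_∣ (sym (swap-neg-fst a b nza)))) pb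
  ... | is--b refl = subst P (trans (sym (ℤ.∣-i∣≡∣i∣ a)) (cong ∣_∣ (sym (swap-neg-snd a b nzb)))) pa
  ... | other p q  = subst P (cong ∣_∣ (sym (swap-other a b x p q))) px

-- An odd injective `g` transports each of the four equality tests in `swap`, so conjugating a
-- reflection by `g` just applies `g` to its endpoints. This relation drives all later manipulations
-- of factorizations, with `g` itself a swap.
swap-conj : ∀ (g : ℤ → ℤ) → (∀ x → g (- x) ≡ - g x) → (∀ x y → g x ≡ g y → x ≡ y) →
            ∀ c d x → g (swap c d x) ≡ swap (g c) (g d) (g x)
swap-conj g odd inj c d x
  rewrite isYes-cong (g x ℤ.≟ g c) (x ℤ.≟ c) (inj x c) (cong g)
        | isYes-cong (g x ℤ.≟ g d) (x ℤ.≟ d) (inj x d) (cong g)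
        | sym (odd c) | sym (odd d)
        | isYes-cong (g x ℤ.≟ g (- c)) (x ℤ.≟ - c) (inj x (- c)) (cong g)
        | isYes-cong (g x ℤ.≟ g (- d)) (x ℤ.≟ - d) (inj x (- d)) (cong g)
  with x ℤ.≟ c | x ℤ.≟ d | x ℤ.≟ - c | x ℤ.≟ - d
... | yes _ | _     | _     | _     = refl
... | no _  | yes _ | _     | _     = refl
... | no _  | no _  | yes _ | _     = refl
... | no _  | no _  | no _  | yes _ = refl
... | no _  | no _  | no _  | no _  = refl

-- The set of sequences in which both codes take values, built at the right end because the growth
-- step for `n + 1` is governed by the last letter.
data Code : ℕ → Set where
  ε    : Code 0
  snoc : ∀ {n} → Code n → (x : ℤ) → InR (suc n) x → Code (suc n)

toList : ∀ {n} → Code n → Word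
toList ε            = []
toList (snoc c x _) = toList c ∷ʳ x

length-toList : ∀ {n} (c : Code n) → length (toList c) ≡ n
length-toList ε                = refl
length-toList (snoc c x _)     =
  trans (length-++ (toList c)) (trans (ℕ.+-comm _ 1) (cong suc (length-toList c)))

toList-injective : ∀ {n} (c d : Code n) → toList c ≡ toList d → c ≡ d
toList-injective ε ε _ = refl
toList-injective (snoc c x (p , q)) (snoc d y (p′ , q′)) e
  with e₁ , refl ← ∷ʳ-injective (toList c) (toList d) e
  with refl ← toList-injective c d e₁
     | refl ← ℕ.≤-irrelevant p p′ | refl ← ℕ.≤-irrelevant q q′ = refl

-- The signed permutation as a map on all integers, fixing every `z` with `∣ z ∣ > n`; factors for
-- different `n` then compose without restriction maps.
Φ Φ⁻¹ : ∀ {n} → Code n → ℤ → ℤ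
Φ ε                    z = z
Φ (snoc {n} c x _)     z = Φ c (swap x (+ suc n) z)
Φ⁻¹ ε                  z = z
Φ⁻¹ (snoc {n} c x _)   z = swap x (+ suc n) (Φ⁻¹ c z)

Φ-Φ⁻¹ : ∀ {n} (c : Code n) z → Φ c (Φ⁻¹ c z) ≡ z
Φ-Φ⁻¹ ε z = refl
Φ-Φ⁻¹ (snoc {n} c x (p , _)) z =
  trans (cong (Φ c) (swap-involutive x (+ suc n) p (s≤s z≤n) (Φ⁻¹ c z))) (Φ-Φ⁻¹ c z)

Φ⁻¹-Φ : ∀ {n} (c : Code n) z → Φ⁻¹ c (Φ c z) ≡ z
Φ⁻¹-Φ ε z = refl
Φ⁻¹-Φ (snoc {n} c x (p , _)) z =
  trans (cong (swap x (+ suc n)) (Φ⁻¹-Φ c _)) (swap-involutive x (+ suc n) p (s≤s z≤n) z)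

Φ-odd : ∀ {n} (c : Code n) z → Φ c (- z) ≡ - Φ c z
Φ-odd ε z = refl
Φ-odd (snoc {n} c x (p , _)) z = trans (cong (Φ c) (swap-odd x (+ suc n) p (s≤s z≤n) z)) (Φ-odd c _)

Φ⁻¹-odd : ∀ {n} (c : Code n) z → Φ⁻¹ c (- z) ≡ - Φ⁻¹ c z
Φ⁻¹-odd ε z = refl
Φ⁻¹-odd (snoc {n} c x (p , _)) z =
  trans (cong (swap x (+ suc n)) (Φ⁻¹-odd c z)) (swap-odd x (+ suc n) p (s≤s z≤n) (Φ⁻¹ c z))

Φ-injective : ∀ {n} (c : Code n) y z → Φ c y ≡ Φ c z → y ≡ z
Φ-injective c y z e = trans (sym (Φ⁻¹-Φ c y)) (trans (cong (Φ⁻¹ c) e) (Φ⁻¹-Φ c z))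

Φ-∣∣-injective : ∀ {n} (c : Code n) y z → ∣ Φ c y ∣ ≡ ∣ Φ c z ∣ → ∣ y ∣ ≡ ∣ z ∣
Φ-∣∣-injective c y z e with ∣∣-cases _ _ e
... | inj₁ e′ = cong ∣_∣ (Φ-injective c y z e′)
... | inj₂ e′ = trans (cong ∣_∣ (Φ-injective c y (- z) (trans e′ (sym (Φ-odd c z))))) (ℤ.∣-i∣≡∣i∣ z)

Φ-fixes : ∀ {n} (c : Code n) z → n < ∣ z ∣ → Φ c z ≡ z
Φ-fixes ε              z _ = refl
Φ-fixes (snoc {n} c x (_ , q)) z l =
  trans (cong (Φ c) (swap-other x (+ suc n) z (λ e → ℕ.<⇒≱ l (subst (_≤ _) (sym e) q)) (ℕ.<⇒≢ l ∘ sym)))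
        (Φ-fixes c z (ℕ.<⇒≤ l))

Φ⁻¹-fixes : ∀ {n} (c : Code n) z → n < ∣ z ∣ → Φ⁻¹ c z ≡ z
Φ⁻¹-fixes c z l = trans (cong (Φ⁻¹ c) (sym (Φ-fixes c z l))) (Φ⁻¹-Φ c z)

Φ-range : ∀ {n} (c : Code n) {m} z → n ≤ m → InR m z → InR m (Φ c z)
Φ-range ε            z _ r = r
Φ-range (snoc {n} c x (p , q)) {m} z l r =
  Φ-range c _ (ℕ.<⇒≤ l)
    (swap-preserves x (+ suc n) p (s≤s z≤n) (Range m) (p , ℕ.≤-trans q l) (s≤s z≤n , l) z r)

Φ⁻¹-range : ∀ {n} (c : Code n) {m} z → n ≤ m → InR m z → InR m (Φ⁻¹ c z)
Φ⁻¹-range ε            z _ r = r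
Φ⁻¹-range (snoc {n} c x (p , q)) {m} z l r =
  swap-preserves x (+ suc n) p (s≤s z≤n) (Range m) (p , ℕ.≤-trans q l) (s≤s z≤n , l) (Φ⁻¹ c z)
    (Φ⁻¹-range c z (ℕ.<⇒≤ l) r)

φ : ∀ {n} → Code n → Word
φ {n} c = map (λ i → Φ c (+ i)) (range1 n)

length-φ : ∀ {n} (c : Code n) → length (φ c) ≡ n
length-φ {n} c = trans (length-map _ (range1 n)) (length-range1 n)

φ-! : ∀ {n} (c : Code n) i → Range n i → φ c ! i ≡ Φ c (+ i)
φ-! c = map-range1-! (λ i → Φ c (+ i))

φ-IsB : ∀ {n} (c : Code n) → IsB n (φ c)
φ-IsB {n} c = length-φ c
  , All.map⁺ (All.map (λ r → Φ-range c _ ℕ.≤-refl r) (All-range1 n))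
  , subst Unique (trans (sym (map-upTo _ n)) (trans (map-∘ (upTo n)) (map-∘ (range1 n))))
      (Unique.applyUpTo⁺₁ (λ i → ∣ Φ c (+ suc i) ∣) n
        (λ i<j _ e → ℕ.<⇒≢ i<j (ℕ.suc-injective (Φ-∣∣-injective c _ _ e))))

-- Codes of signed permutations

-- If `k` were missed, `k` and the `n` values of `f` would be `n + 1` distinct elements of `[1,n]`.
range-surjective : ∀ n (f : ℕ → ℕ) → (∀ i → Range n i → Range n (f i)) →
                   (∀ i j → Range n i → Range n j → f i ≡ f j → i ≡ j) →
                   ∀ k → Range n k → ∃ λ i → Range n i × f i ≡ k
range-surjective n f f-range f-inj k k∈ with k ∈? map f (range1 n)
... | yes k∈fs with i , i∈ , e ← ∈-map⁻ f k∈fs = i , All.lookup (All-range1 n) i∈ , sym e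
... | no k∉fs = contradiction (Unique-length≤ (All.¬Any⇒All¬ _ k∉fs ∷ unique) (k∈ ∷ ranges))
                  (λ l → ℕ.<-irrefl (trans (length-map f (range1 n)) (length-range1 n)) l)
  where
  ranges : All (Range n) (map f (range1 n))
  ranges = All.map⁺ (All.map (f-range _) (All-range1 n))
  unique : Unique (map f (range1 n))
  unique = subst Unique (trans (sym (map-upTo _ n)) (map-∘ (upTo n)))
    (Unique.applyUpTo⁺₁ (f ∘ suc) n (λ i<j j<n e → ℕ.<⇒≢ i<j (ℕ.suc-injective
      (f-inj _ _ (s≤s z≤n , ℕ.<-trans i<j j<n) (s≤s z≤n , j<n) e))))

app-odd : ∀ w z → app w (- z) ≡ - app w z
app-odd w (+ zero)   = refl
app-odd w (+ suc k)  = refl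
app-odd w -[1+ k ]   = sym (ℤ.neg-involutive _)

∣app∣ : ∀ w z → 1 ≤ ∣ z ∣ → ∣ app w z ∣ ≡ ∣ w ! ∣ z ∣ ∣
∣app∣ w (+ suc k)  _ = refl
∣app∣ w -[1+ k ]   _ = ℤ.∣-i∣≡∣i∣ (w ! suc k)

-- Range and injectivity are asked only on letters of absolute value in `[1,n]`, because `app w`
-- vanishes outside the window. Unlike words, this class of maps is convenient to compose with swaps
-- and to restrict to a smaller `n`.
record SignedPerm (n : ℕ) (g : ℤ → ℤ) : Set where
  field
    odd       : ∀ z → g (- z) ≡ - g z
    range     : ∀ z → InR n z → InR n (g z)
    injective : ∀ y z → InR n y → InR n z → ∣ g y ∣ ≡ ∣ g z ∣ → ∣ y ∣ ≡ ∣ z ∣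

Unique-!-injective : ∀ w i j → Unique (map ∣_∣ w) → Range (length w) i → Range (length w) j →
                     ∣ w ! i ∣ ≡ ∣ w ! j ∣ → i ≡ j
Unique-!-injective (x ∷ w) 1 1 _ _ _ _ = refl
Unique-!-injective (x ∷ w) 1 (suc (suc j)) (x∉ ∷ _) _ (_ , s≤s q) e =
  contradiction e (!-All (All.map⁻ x∉) (suc j) (s≤s z≤n , q))
Unique-!-injective (x ∷ w) (suc (suc i)) 1 (x∉ ∷ _) (_ , s≤s q) _ e =
  contradiction (sym e) (!-All (All.map⁻ x∉) (suc i) (s≤s z≤n , q))
Unique-!-injective (x ∷ w) (suc (suc i)) (suc (suc j)) (_ ∷ u) (_ , s≤s p) (_ , s≤s q) e =
  cong suc (Unique-!-injective w (suc i) (suc j) u (s≤s z≤n , p) (s≤s z≤n , q) e)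

module _ {n : ℕ} {w : Word} (b : IsB n w) where

  private
    lift : ∀ {i} → Range n i → Range (length w) i
    lift = subst (λ m → Range m _) (sym (proj₁ b))

  IsB-range : ∀ i → Range n i → InR n (w ! i)
  IsB-range i r = !-All (proj₁ (proj₂ b)) i (lift r)

  IsB-injective : ∀ i j → Range n i → Range n j → ∣ w ! i ∣ ≡ ∣ w ! j ∣ → i ≡ j
  IsB-injective i j r s = Unique-!-injective w i j (proj₂ (proj₂ b)) (lift r) (lift s)

  IsB-surjective : ∀ k → Range n k → ∃ λ i → Range n i × ∣ w ! i ∣ ≡ k
  IsB-surjective = range-surjective n (λ i → ∣ w ! i ∣) IsB-range IsB-injective

  IsB⇒SignedPerm : SignedPerm n (app w)
  IsB⇒SignedPerm = record
    { odd       = app-odd w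
    ; range     = λ z r → subst (Range n) (sym (∣app∣ w z (proj₁ r))) (IsB-range _ r)
    ; injective = λ y z r s e → IsB-injective _ _ r s
                    (trans (sym (∣app∣ w y (proj₁ r))) (trans e (∣app∣ w z (proj₁ s))))
    }

preimage-of-max : ∀ {n g} → SignedPerm (suc n) g → ∃ λ x → InR (suc n) x × g x ≡ + suc n
preimage-of-max {n} {g} sp
  with k , r , e ← range-surjective (suc n) (λ k → ∣ g (+ k) ∣) (λ k → SignedPerm.range sp (+ k))
                     (λ i j → SignedPerm.injective sp (+ i) (+ j)) (suc n) (s≤s z≤n , ℕ.≤-refl)
  with ∣∣-cases (g (+ k)) (+ suc n) e
... | inj₁ e′ = + k , r , e′
... | inj₂ e′ = - + k , subst (Range _) (sym (ℤ.∣-i∣≡∣i∣ (+ k))) r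
              , trans (SignedPerm.odd sp (+ k)) (cong -_ e′)

∣∣-≤suc : ∀ {n z} → InR (suc n) z → ∣ z ∣ ≢ suc n → InR n z
∣∣-≤suc (p , q) ne = p , ℕ.≤-pred (ℕ.≤∧≢⇒< q ne)

-- Let `x` be the preimage of `n + 1`. Precomposing `g` with the swap of `x` and `n + 1` gives a map
-- fixing `n + 1`; by injectivity it preserves the smaller letters, so induction applies, and `x` is
-- the last letter of the code.
SignedPerm⇒Φ : ∀ n g → SignedPerm n g → ∃ λ (c : Code n) → ∀ z → InR n z → g z ≡ Φ c z
SignedPerm⇒Φ zero    g _  = ε , λ z r → contradiction (ℕ.≤-trans (proj₁ r) (proj₂ r)) ℕ.1+n≰n
SignedPerm⇒Φ (suc n) g sp
  with x , x∈@(x≥1 , x≤) , gx≡N ← preimage-of-max sp = snoc c x x∈ , agree′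
  where
  open SignedPerm sp
  N : ℤ
  N = + suc n
  N∈ : InR (suc n) N
  N∈ = s≤s z≤n , ℕ.≤-refl
  s : ℤ → ℤ
  s = swap x N
  h : ℤ → ℤ
  h z = g (s z)
  s-range : ∀ z → InR (suc n) z → InR (suc n) (s z)
  s-range = swap-preserves x N x≥1 (s≤s z≤n) (Range (suc n)) x∈ N∈
  s-inj : ∀ y z → ∣ s y ∣ ≡ ∣ s z ∣ → ∣ y ∣ ≡ ∣ z ∣
  s-inj y z e with ∣∣-cases (s y) (s z) e
  ... | inj₁ e′ = cong ∣_∣ (swap-injective x N x≥1 (s≤s z≤n) y z e′)
  ... | inj₂ e′ = trans (cong ∣_∣ (swap-injective x N x≥1 (s≤s z≤n) y (- z)
                    (trans e′ (sym (swap-odd x N x≥1 (s≤s z≤n) z))))) (ℤ.∣-i∣≡∣i∣ z)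
  h-inj : ∀ y z → InR (suc n) y → InR (suc n) z → ∣ h y ∣ ≡ ∣ h z ∣ → ∣ y ∣ ≡ ∣ z ∣
  h-inj y z r t e = s-inj y z (injective _ _ (s-range y r) (s-range z t) e)
  hN : h N ≡ N
  hN = trans (cong g (swap-snd x N)) gx≡N
  h-sp : SignedPerm n h
  h-sp = record
    { odd       = λ z → trans (cong g (swap-odd x N x≥1 (s≤s z≤n) z)) (odd (s z))
    ; range     = λ z r → ∣∣-≤suc {z = h z} (range (s z) (s-range z (Range-suc r)))
                    (λ e → ℕ.<⇒≱ (ℕ.≤-reflexive (sym (h-inj z N (Range-suc r) N∈ (trans e (cong ∣_∣ (sym hN)))))) (proj₂ r))
    ; injective = λ y z r t → h-inj y z (Range-suc r) (Range-suc t)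
    }
  c : Code n
  c = proj₁ (SignedPerm⇒Φ n h h-sp)
  -- The induction hypothesis does not reach the letters `± (n + 1)`; there both maps are the
  -- identity.
  agree : ∀ z → InR (suc n) z → h z ≡ Φ c z
  agree z r with ∣ z ∣ ℕ.≟ suc n
  ... | no ne = proj₂ (SignedPerm⇒Φ n h h-sp) z (∣∣-≤suc {z = z} r ne)
  ... | yes e = trans (hz (∣∣-cases z N e)) (sym (Φ-fixes c z (ℕ.≤-reflexive (sym e))))
    where
    hz : z ≡ N ⊎ z ≡ - N → h z ≡ z
    hz (inj₁ refl) = hN
    hz (inj₂ refl) = trans (cong g (swap-odd x N x≥1 (s≤s z≤n) N)) (trans (odd (s N)) (cong -_ hN))
  agree′ : ∀ z → InR (suc n) z → g z ≡ Φ c (s z)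
  agree′ z r = trans (cong g (sym (swap-involutive x N x≥1 (s≤s z≤n) z))) (agree (s z) (s-range z r))

IsB⇒φ : ∀ {n w} → IsB n w → ∃ λ (c : Code n) → w ≡ φ c
IsB⇒φ {n} {w} b with c , e ← SignedPerm⇒Φ n (app w) (IsB⇒SignedPerm b) =
  c , word-ext w (φ c) (proj₁ b) (length-φ c)
        (λ { (suc i) r → trans (e (+ suc i) r) (sym (φ-! c (suc i) r)) })

-- Words grown by inserting the largest letter

ins : ℕ → ℤ → Word → Word
ins zero    y w       = y ∷ w
ins (suc k) y []      = y ∷ []
ins (suc k) y (z ∷ w) = z ∷ ins k y w

ins-↭ : ∀ k y w → ins k y w ↭ y ∷ w
ins-↭ zero    y w       = ↭-refl
ins-↭ (suc k) y []      = ↭-refl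
ins-↭ (suc k) y (z ∷ w) = ↭-trans (prep z (ins-↭ k y w)) (↭-swap z y ↭-refl)

length-ins : ∀ k y w → length (ins k y w) ≡ suc (length w)
length-ins k y w = ↭.↭-length (ins-↭ k y w)

ins-++ : ∀ us y vs → us ++ y ∷ vs ≡ ins (length us) y (us ++ vs)
ins-++ []       y vs = refl
ins-++ (u ∷ us) y vs = cong (u ∷_) (ins-++ us y vs)

Unique-resp-↭ : ∀ {xs ys : List ℕ} → xs ↭ ys → Unique xs → Unique ys
Unique-resp-↭ p = ↭ₛ.Unique-resp-↭ (setoid ℕ) (↭⇒↭ₛ p)

ins-IsB⁺ : ∀ {n} k y w → ∣ y ∣ ≡ suc n → IsB n w → IsB (suc n) (ins k y w)
ins-IsB⁺ {n} k y w e (len , rng , uniq) =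
    trans (length-ins k y w) (cong suc len)
  , ↭.All-resp-↭ (↭-sym (ins-↭ k y w)) (subst (Range (suc n)) (sym e) (s≤s z≤n , ℕ.≤-refl) ∷ All.map Range-suc rng)
  , Unique-resp-↭ (↭-sym (↭.map⁺ ∣_∣ (ins-↭ k y w)))
      (All.map⁺ (All.map (λ r y≡ → ℕ.<⇒≱ (ℕ.≤-reflexive (trans (sym e) y≡)) (proj₂ r)) rng) ∷ uniq)

ins-IsB⁻ : ∀ {n} k y w → ∣ y ∣ ≡ suc n → IsB (suc n) (ins k y w) → IsB n w
ins-IsB⁻ {n} k y w e (len , rng , uniq)
  with y∉ ∷ uniq′ ← Unique-resp-↭ (↭.map⁺ ∣_∣ (ins-↭ k y w)) uniq
     | _ ∷ rng′ ← ↭.All-resp-↭ (ins-↭ k y w) rng =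
    ℕ.suc-injective (trans (sym (length-ins k y w)) len)
  , All.zipWith (λ { {z} (r , ne) → ∣∣-≤suc {z = z} r (λ e′ → ne (trans e (sym e′))) }) (rng′ , All.map⁻ y∉)
  , uniq′

∣signed∣ : ∀ x m → ∣ signed x m ∣ ≡ m
∣signed∣ (+ _)    m = refl
∣signed∣ -[1+ _ ] m = ℤ.∣-i∣≡∣i∣ (+ m)

signed-signed : ∀ x k m → signed (signed x (suc k)) m ≡ signed x m
signed-signed (+ _)    k m = refl
signed-signed -[1+ _ ] k m = refl

signed-∣∣ : ∀ x → signed x ∣ x ∣ ≡ x
signed-∣∣ (+ _)    = refl
signed-∣∣ -[1+ _ ] = refl

α : ∀ {n} → Code n → Word
α ε                = []
-- `ins` counts places from 0, so position `∣ x ∣` of the window has index `∣ x ∣ ∸ 1`.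
α (snoc {n} c x _) = ins (∣ x ∣ ∸ 1) (signed x (suc n)) (α c)

α-IsB : ∀ {n} (c : Code n) → IsB n (α c)
α-IsB ε                = refl , [] , []
α-IsB (snoc {n} c x _) = ins-IsB⁺ (∣ x ∣ ∸ 1) _ (α c) (∣signed∣ x (suc n)) (α-IsB c)

length-α : ∀ {n} (c : Code n) → length (α c) ≡ n
length-α c = proj₁ (α-IsB c)

IsB⇒α : ∀ {n w} → IsB n w → ∃ λ (c : Code n) → w ≡ α c
IsB⇒α {zero}  {[]} _ = ε , refl
IsB⇒α {suc n} {w}  b
  with i , r , e ← IsB-surjective b (suc n) (s≤s z≤n , ℕ.≤-refl)
  with us , vs , w≡ ← ∈-∃++ (!-∈ {w} i (subst (λ m → Range m i) (sym (proj₁ b)) r))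
  with c , e′ ← IsB⇒α {n} {us ++ vs} (ins-IsB⁻ (length us) (w ! i) (us ++ vs) e
                   (subst (IsB (suc n)) (trans w≡ (ins-++ us (w ! i) vs)) b)) =
  snoc c x x∈ , (begin
    w                                         ≡⟨ w≡ ⟩
    us ++ w ! i ∷ vs                          ≡⟨ ins-++ us (w ! i) vs ⟩
    ins (length us) (w ! i) (us ++ vs)        ≡⟨ cong (ins (length us) (w ! i)) e′ ⟩
    ins (length us) (w ! i) (α c)             ≡⟨ cong₂ (λ k y → ins k y (α c)) (cong (_∸ 1) (sym ∣x∣≡)) y≡ ⟩
    ins (∣ x ∣ ∸ 1) (signed x (suc n)) (α c)  ∎)
  where
  open ≡-Reasoning
  -- The letter `± (n + 1)` stands right after `us`; its position and its sign are those recorded in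
  -- `x`.
  x : ℤ
  x = signed (w ! i) (suc (length us))
  ∣x∣≡ : ∣ x ∣ ≡ suc (length us)
  ∣x∣≡ = ∣signed∣ (w ! i) _
  us≤n : length us ≤ n
  us≤n = ℕ.≤-trans (ℕ.m≤m+n _ (length vs)) (ℕ.≤-reflexive (trans (sym (length-++ us)) (trans (cong length e′) (length-α c))))
  x∈ : InR (suc n) x
  x∈ = subst (Range (suc n)) (sym ∣x∣≡) (s≤s z≤n , s≤s us≤n)
  y≡ : w ! i ≡ signed x (suc n)
  y≡ = trans (sym (signed-∣∣ (w ! i))) (trans (cong (signed (w ! i)) e) (sym (signed-signed (w ! i) (length us) (suc n))))

-- The B-code

-- A terminating run of `g`: the list holds the states passed before stopping, the last index is the
-- state where the run stops. Both `bstep` and `orbit` are instances, with the fuel replaced by the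
-- length of the list.
data Path {S : Set} (g : S → S) (Stop : S → Set) : S → List S → S → Set where
  stop : ∀ {x} → Stop x → Path g Stop x [] x
  step : ∀ {x ys r} → ¬ Stop x → Path g Stop (g x) ys r → Path g Stop x (x ∷ ys) r

module _ {S : Set} {g : S → S} {Stop : S → Set} where

  Path-deterministic : ∀ {x ys zs r s} → Path g Stop x ys r → Path g Stop x zs s → ys ≡ zs
  Path-deterministic (stop _)   (stop _)   = refl
  Path-deterministic (stop s)   (step ¬s _) = contradiction s ¬s
  Path-deterministic (step ¬s _) (stop s)   = contradiction s ¬s
  Path-deterministic (step _ p) (step _ q) = cong (_ ∷_) (Path-deterministic p q)

  Path-suffix : ∀ {x ys r z} → Path g Stop x ys r → z ∈ ys →
                ∃ λ zs → Path g Stop z zs r × length zs ≤ length ys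
  Path-suffix p@(step _ _) (here refl) = _ , p , ℕ.≤-refl
  Path-suffix (step _ p)   (there z∈) with zs , q , l ← Path-suffix p z∈ = zs , q , ℕ.m≤n⇒m≤1+n l

  -- A state met again would start a strictly shorter run of its own, although the run from a given
  -- state is determined by it.
  Path-unique : ∀ {x ys r} → Path g Stop x ys r → Unique ys
  Path-unique (stop _) = []
  Path-unique {x} {ys = .x ∷ ys} p@(step _ q) = All.tabulate fresh ∷ Path-unique q
    where
    fresh : ∀ {y} → y ∈ ys → x ≢ y
    fresh y∈ refl with zs , q′ , l ← Path-suffix q y∈ =
      ℕ.<⇒≱ (s≤s l) (ℕ.≤-reflexive (cong length (Path-deterministic p q′)))

  Path-going : ∀ {x ys r} → Path g Stop x ys r → All (¬_ ∘ Stop) ys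
  Path-going (stop _)   = []
  Path-going (step s p) = s ∷ Path-going p

  Path-All : ∀ {P : S → Set} → (∀ x → P x → P (g x)) → ∀ {x ys r} → Path g Stop x ys r → P x → All P ys
  Path-All f (stop _)   _  = []
  Path-All f (step _ p) px = px ∷ Path-All f p (f _ px)

Path-map : ∀ {S S′ : Set} {g : S → S} {g′ : S′ → S′} {Stop Stop′} (h : S → S′) →
           (∀ x → h (g x) ≡ g′ (h x)) → (∀ x → Stop x → Stop′ (h x)) → (∀ x → Stop′ (h x) → Stop x) →
           ∀ {x ys r} → Path g Stop x ys r → Path g′ Stop′ (h x) (map h ys) (h r)
Path-map h comm f f⁻ (stop s)   = stop (f _ s)
Path-map {g′ = g′} {Stop′ = Stop′} h comm f f⁻ (step s p) =
  step (s ∘ f⁻ _) (subst (λ y → Path g′ Stop′ y _ _) (comm _) (Path-map h comm f f⁻ p))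

-- The local function of `pre` cannot be named, so it is recovered by unification.
mutual
  preFrom : Word → ℕ → ℕ → Word → ℤ
  preFrom = _

  pre-unfold : ∀ x xs i → pre (x ∷ xs) i ≡
    (if x ==ᶻ (+ i) then + 1 else if x ==ᶻ (- (+ i)) then - (+ 1) else preFrom (x ∷ xs) i (suc 1) xs)
  pre-unfold x xs i with x ==ᶻ (+ i) | x ==ᶻ (- (+ i))
  ... | true  | _     = refl
  ... | false | true  = refl
  -- After this abstraction all arguments of the unknown function are distinct variables, so the
  -- equation is a Miller pattern and has a unique solution.
  ... | false | false with suc 1 | x ∷ xs
  ...   | p | W = refl

-- Moves a signed position one place away from 0. The value 0, with which `pre` reports an absent
-- letter, must stay 0.
shift : ℤ → ℤ
shift (+ zero)  = + zero
shift (+ suc k) = + suc (suc k)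
shift -[1+ k ]  = -[1+ suc k ]

preFrom-shift : ∀ V W i p xs → preFrom V i (suc (suc p)) xs ≡ shift (preFrom W i (suc p) xs)
preFrom-shift V W i p []       = refl
preFrom-shift V W i p (x ∷ xs) with x ==ᶻ (+ i) | x ==ᶻ (- (+ i))
... | true  | _     = refl
... | false | true  = refl
... | false | false = preFrom-shift V W i (suc p) xs

pre-∷ : ∀ x xs i → pre (x ∷ xs) i ≡
  (if x ==ᶻ (+ i) then + 1 else if x ==ᶻ (- (+ i)) then - (+ 1) else shift (pre xs i))
pre-∷ x xs i rewrite sym (preFrom-shift (x ∷ xs) xs i 0 xs) = pre-unfold x xs i

pre-here⁺ : ∀ i xs → pre (+ i ∷ xs) i ≡ + 1
pre-here⁺ i xs rewrite pre-∷ (+ i) xs i | isYes-true (+ i ℤ.≟ + i) refl = refl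

pre-here⁻ : ∀ i xs → 1 ≤ i → pre (- + i ∷ xs) i ≡ - + 1
pre-here⁻ i xs i≥1
  rewrite pre-∷ (- + i) xs i | isYes-false (- + i ℤ.≟ + i) (x≢-x {+ i} i≥1 ∘ sym)
        | isYes-true (- + i ℤ.≟ - + i) refl = refl

pre-there : ∀ x xs i → ∣ x ∣ ≢ i → pre (x ∷ xs) i ≡ shift (pre xs i)
pre-there x xs i ne
  rewrite pre-∷ x xs i | isYes-false (x ℤ.≟ + i) (ne ∘ cong ∣_∣)
        | isYes-false (x ℤ.≟ - + i) (λ e → ne (trans (cong ∣_∣ e) (ℤ.∣-i∣≡∣i∣ (+ i)))) = refl

pre-unique : ∀ w i k → 1 ≤ i → Range (length w) k → (∀ j → 1 ≤ j → j < k → ∣ w ! j ∣ ≢ i) →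
             (w ! k ≡ + i → pre w i ≡ + k) × (w ! k ≡ - + i → pre w i ≡ - + k)
pre-unique (x ∷ w) i 1 i≥1 _ _ = (λ { refl → pre-here⁺ i w }) , (λ { refl → pre-here⁻ i w i≥1 })
pre-unique (x ∷ w) i (suc (suc k)) i≥1 (_ , s≤s q) h =
    (λ e → trans x≢ (cong shift (proj₁ rec e))) , (λ e → trans x≢ (cong shift (proj₂ rec e)))
  where
  x≢ : pre (x ∷ w) i ≡ shift (pre w i)
  x≢ = pre-there x w i (h 1 ℕ.≤-refl (s≤s (s≤s z≤n)))
  rec = pre-unique w i (suc k) i≥1 (s≤s z≤n , q)
          (λ { (suc j) _ j<k → h (suc (suc j)) (s≤s z≤n) (s≤s j<k) })

app-φ : ∀ {n} (c : Code n) z → InR n z → app (φ c) z ≡ Φ c z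
app-φ c (+ suc k)  r = φ-! c (suc k) r
app-φ c -[1+ k ]   r = trans (cong -_ (φ-! c (suc k) r)) (sym (Φ-odd c (+ suc k)))

-- With `t` the preimage of `i`, the letter `± i` stands at position `∣ t ∣`. Since absolute values
-- are distinct no earlier letter matches, so the search in `pre` stops exactly there, and its sign
-- agrees with that of `t`.
pre-φ : ∀ {n} (c : Code n) i → Range n i → pre (φ c) i ≡ Φ⁻¹ c (+ i)
pre-φ {n} c i r = by-sign t refl
  where
  t = Φ⁻¹ c (+ i)
  t∈ : InR n t
  t∈ = Φ⁻¹-range c (+ i) ℕ.≤-refl r
  φ∣t∣ : app (φ c) t ≡ + i
  φ∣t∣ = trans (app-φ c t t∈) (Φ-Φ⁻¹ c (+ i))
  first : ∀ j → 1 ≤ j → j < ∣ t ∣ → ∣ φ c ! j ∣ ≢ i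
  first j p q e = ℕ.<⇒≢ q (IsB-injective (φ-IsB c) j ∣ t ∣ (p , ℕ.≤-trans (ℕ.<⇒≤ q) (proj₂ t∈)) t∈
    (trans e (trans (cong ∣_∣ (sym φ∣t∣)) (∣app∣ (φ c) t (proj₁ t∈)))))
  unique = pre-unique (φ c) i ∣ t ∣ (proj₁ r) (subst (λ m → Range m ∣ t ∣) (sym (length-φ c)) t∈) first
  by-sign : ∀ s → s ≡ t → pre (φ c) i ≡ t
  by-sign (+ zero)  e = contradiction (proj₁ (subst (InR n) (sym e) t∈)) λ ()
  by-sign (+ suc k) e = trans (proj₁ unique (subst (λ s → φ c ! ∣ s ∣ ≡ + i) e (subst (λ s → app (φ c) s ≡ + i) (sym e) φ∣t∣)))
                          (trans (cong (λ s → + ∣ s ∣) (sym e)) e)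
  by-sign -[1+ k ]  e = trans (proj₂ unique (subst (λ s → φ c ! ∣ s ∣ ≡ - + i) e
                            (-≡⇒≡- (subst (λ s → app (φ c) s ≡ + i) (sym e) φ∣t∣))))
                          (trans (cong (λ s → - + ∣ s ∣) (sym e)) e)

appInv-φ : ∀ {n} (c : Code n) z → InR n z → appInv (φ c) z ≡ Φ⁻¹ c z
appInv-φ c (+ k)     r = pre-φ c k r
appInv-φ c -[1+ k ]  r = trans (cong -_ (pre-φ c (suc k) r)) (sym (Φ⁻¹-odd c (+ suc k)))

FirstReturn : ∀ {n} → Code n → ℕ → ℤ → List ℤ → ℤ → Set
FirstReturn c i = Path (Φ⁻¹ c) (λ z → ∣ z ∣ ≤ i)

Φ⁻¹-snoc-max : ∀ {n} (c : Code n) x r → Φ⁻¹ (snoc c x r) (+ suc n) ≡ x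
Φ⁻¹-snoc-max {n} c x r = trans (cong (swap x (+ suc n)) (Φ⁻¹-fixes c (+ suc n) ℕ.≤-refl)) (swap-snd x (+ suc n))

module _ {n : ℕ} (c : Code n) (x : ℤ) (x∈ : InR (suc n) x) (i : ℕ) (i≤n : i ≤ n) where

  private
    c′ = snoc c x x∈
    N : ℤ
    N = + suc n

  FirstReturn-snoc : ∀ {z ys r} → InR n z → FirstReturn c i z ys r →
                     ∃ λ ys′ → FirstReturn c′ i (swap x N z) ys′ r
  FirstReturn-same : ∀ {z ys r} → InR n z → FirstReturn c i z ys r →
                     ∃ λ ys′ → FirstReturn c′ i z ys′ r

  FirstReturn-same z∈ (stop s)   = _ , stop s
  FirstReturn-same {z} z∈ (step s p) with ys , q ← FirstReturn-snoc (Φ⁻¹-range c z ℕ.≤-refl z∈) p =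
    _ , step s q

  -- Where the old path visits ±x, the new one visits ±N just before.
  FirstReturn-snoc {z} z∈ p with ys , q ← FirstReturn-same z∈ p with swapView x N z
  ... | is-a refl  = _ , subst (λ y → FirstReturn c′ i y (N ∷ ys) _) (sym (swap-fst x N))
        (step (ℕ.<⇒≱ (s≤s i≤n)) (subst (λ y → FirstReturn c′ i y ys _) (sym (Φ⁻¹-snoc-max c x x∈)) q))
  ... | is--a refl = _ , subst (λ y → FirstReturn c′ i y (- N ∷ ys) _) (sym (swap-neg-fst x N (proj₁ x∈)))
        (step (ℕ.<⇒≱ (s≤s i≤n)) (subst (λ y → FirstReturn c′ i y ys _)
          (sym (trans (Φ⁻¹-odd c′ N) (cong -_ (Φ⁻¹-snoc-max c x x∈)))) q))
  ... | is-b refl  = contradiction (proj₂ z∈) (ℕ.<⇒≱ ℕ.≤-refl)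
  ... | is--b refl = contradiction (proj₂ z∈) (ℕ.<⇒≱ ℕ.≤-refl)
  ... | other e f  = ys , subst (λ y → FirstReturn c′ i y ys _) (sym (swap-other x N z e f)) q

∷ʳ-!-init : ∀ w x i → Range (length w) i → (w ∷ʳ x) ! i ≡ w ! i
∷ʳ-!-init (y ∷ w) x 1             _           = refl
∷ʳ-!-init (y ∷ w) x (suc (suc i)) (_ , s≤s q) = ∷ʳ-!-init w x (suc i) (s≤s z≤n , q)

∷ʳ-!-last : ∀ w x → (w ∷ʳ x) ! suc (length w) ≡ x
∷ʳ-!-last []      x = refl
∷ʳ-!-last (y ∷ w) x = ∷ʳ-!-last w x

toList-!-init : ∀ {n} (c : Code n) x r i → Range n i → toList (snoc c x r) ! i ≡ toList c ! i
toList-!-init c x _ i i∈ = ∷ʳ-!-init (toList c) x i (subst (λ m → Range m i) (sym (length-toList c)) i∈)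

toList-!-last : ∀ {n} (c : Code n) x r → toList (snoc c x r) ! suc n ≡ x
toList-!-last c x _ = subst (λ m → (toList c ∷ʳ x) ! suc m ≡ x) (length-toList c) (∷ʳ-!-last (toList c) x)

-- For the last index `Φ⁻¹` sends `n + 1` directly to `x`, which already stops the run. For a
-- smaller index, appending a letter only adds detours through `± (n + 1)`, where the run cannot
-- stop.
first-return : ∀ {n} (c : Code n) i → Range n i →
               ∃ λ ys → FirstReturn c i (Φ⁻¹ c (+ i)) ys (toList c ! i)
first-return ε i (p , q) = contradiction (ℕ.≤-trans p q) ℕ.1+n≰n
first-return {suc n} c′@(snoc c x r) i (p , q) with ℕ.m≤n⇒m<n∨m≡n q
... | inj₂ refl = [] , subst₂ (λ y z → FirstReturn c′ (suc n) y [] z)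
                         (sym (Φ⁻¹-snoc-max c x r)) (sym (toList-!-last c x r)) (stop (proj₂ r))
... | inj₁ (s≤s i≤n) with ys , path ← first-return c i (p , i≤n)
                     with ys′ , path′ ← FirstReturn-snoc c x r i i≤n (Φ⁻¹-range c (+ i) ℕ.≤-refl (p , i≤n)) path =
  ys′ , subst (FirstReturn c′ i _ ys′) (sym (toList-!-init c x r i (p , i≤n))) path′

module _ {n : ℕ} (c : Code n) (i : ℕ) where

  bstep-path : ∀ f y {ys r} → InR n y → FirstReturn c i (Φ⁻¹ c y) ys r → length ys < f →
               bstep f (φ c) i y ≡ r
  bstep-path (suc f) y y∈ p l rewrite appInv-φ c y y∈ with p
  ... | stop s   rewrite ≤ᵇ-true s = refl
  ... | step s q rewrite ≤ᵇ-false (ℕ.≰⇒> s) =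
        bstep-path f (Φ⁻¹ c y) (Φ⁻¹-range c y ℕ.≤-refl y∈) q (ℕ.≤-pred l)

  -- Counting signed states would only give a bound of order `2n`. Oddness lets the run descend to
  -- absolute values, which are then distinct; all of them exceed `i`, so together with `i` they
  -- number at most `n`.
  FirstReturn-length : ∀ {ys r} → Range n i → FirstReturn c i (Φ⁻¹ c (+ i)) ys r → length ys < n
  FirstReturn-length {ys} i∈ p = subst (λ m → suc m ≤ n) (length-map ∣_∣ ys)
    (Unique-length≤
      (All.map⁺ (All.map (λ s e → s (ℕ.≤-reflexive (sym e))) (Path-going p)) ∷ Path-unique abs-path)
      (i∈ ∷ All.map⁺ (Path-All {P = InR n} (λ z → Φ⁻¹-range c z ℕ.≤-refl) p (Φ⁻¹-range c (+ i) ℕ.≤-refl i∈))))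
    where
    abs-comm : ∀ z → ∣ Φ⁻¹ c z ∣ ≡ ∣ Φ⁻¹ c (+ ∣ z ∣) ∣
    abs-comm (+ k)     = refl
    abs-comm -[1+ k ]  = trans (cong ∣_∣ (Φ⁻¹-odd c (+ suc k))) (ℤ.∣-i∣≡∣i∣ (Φ⁻¹ c (+ suc k)))
    abs-path : Path (λ k → ∣ Φ⁻¹ c (+ k) ∣) (_≤ i) _ (map ∣_∣ ys) _
    abs-path = Path-map ∣_∣ abs-comm (λ _ s → s) (λ _ s → s) p

Bcode-φ : ∀ {n} (c : Code n) → Bcode (φ c) ≡ toList c
Bcode-φ {n} c = word-ext _ _
    (trans (length-map _ (range1 (length (φ c)))) (trans (length-range1 _) (length-φ c)))
    (length-toList c) λ i r →
  trans (map-range1-! (λ j → bstep (length (φ c)) (φ c) j (+ j)) i (subst (λ m → Range m i) (sym (length-φ c)) r))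
    (case first-return c i r of λ (ys , p) →
      bstep-path c i (length (φ c)) (+ i) r p
        (subst (length ys <_) (sym (length-φ c)) (FirstReturn-length c i r p)))

-- The A-code

-- How signed positions change when a letter is inserted at index `k`: the first `k` places stay,
-- the later ones move by one.
skip : ℕ → ℤ → ℤ
skip k z = if ∣ z ∣ ℕ.≤ᵇ k then z else shift z

skipℕ : ℕ → ℕ → ℕ
skipℕ k m = if m ℕ.≤ᵇ k then m else suc m

shift-skip : ∀ k z → shift (skip k z) ≡ skip (suc k) (shift z)
shift-skip k (+ zero)  = refl
shift-skip k (+ suc m) with m ℕ.<ᵇ k
... | true  = refl
... | false = refl
shift-skip k -[1+ m ]  with m ℕ.<ᵇ k
... | true  = refl
... | false = refl

∣skip∣ : ∀ k z → ∣ skip k z ∣ ≡ skipℕ k ∣ z ∣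
∣skip∣ k (+ zero)  = refl
∣skip∣ k (+ suc m) with m ℕ.<ᵇ k
... | true  = refl
... | false = refl
∣skip∣ k -[1+ m ]  with m ℕ.<ᵇ k
... | true  = refl
... | false = refl

signed-skip : ∀ k z m → signed (skip k z) m ≡ signed z m
signed-skip k (+ zero)  m = refl
signed-skip k (+ suc l) m with l ℕ.<ᵇ k
... | true  = refl
... | false = refl
signed-skip k -[1+ l ]  m with l ℕ.<ᵇ k
... | true  = refl
... | false = refl

module _ (k : ℕ) where

  skipℕ-cases : ∀ m → (m ≤ k × skipℕ k m ≡ m) ⊎ (k < m × skipℕ k m ≡ suc m)
  skipℕ-cases m with ℕ.≤-<-connex m k
  ... | inj₁ m≤k rewrite ≤ᵇ-true m≤k  = inj₁ (m≤k , refl)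
  ... | inj₂ k<m rewrite ≤ᵇ-false k<m = inj₂ (k<m , refl)

  -- `skipℕ k` is strictly increasing and misses exactly `k + 1`. Hence it respects comparisons,
  -- leaves a threshold up to `k` alone, and raises a threshold from `k` on by one.
  skipℕ-≤ᵇ : ∀ a b → (skipℕ k a ℕ.≤ᵇ skipℕ k b) ≡ (a ℕ.≤ᵇ b)
  skipℕ-≤ᵇ a b with skipℕ-cases a | skipℕ-cases b
  ... | inj₁ (p , e) | inj₁ (q , f) = cong₂ ℕ._≤ᵇ_ e f
  ... | inj₁ (p , e) | inj₂ (q , f) rewrite e | f =
    trans (≤ᵇ-true (ℕ.≤-trans p (ℕ.≤-trans (ℕ.<⇒≤ q) (ℕ.n≤1+n b)))) (sym (≤ᵇ-true (ℕ.≤-trans p (ℕ.<⇒≤ q))))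
  ... | inj₂ (p , e) | inj₁ (q , f) rewrite e | f =
    trans (≤ᵇ-false (ℕ.≤-<-trans q (ℕ.<-trans p ℕ.≤-refl))) (sym (≤ᵇ-false (ℕ.≤-<-trans q p)))
  ... | inj₂ (p , e) | inj₂ (q , f) rewrite e | f = T-ext (ℕ.≤⇒≤ᵇ ∘ ℕ.≤-pred ∘ ℕ.≤ᵇ⇒≤ (suc a) (suc b))
    (λ t → ℕ.≤⇒≤ᵇ (s≤s (ℕ.≤ᵇ⇒≤ a b t)))

  skipℕ-≤ᵇ-below : ∀ a {m} → m ≤ k → (skipℕ k a ℕ.≤ᵇ m) ≡ (a ℕ.≤ᵇ m)
  skipℕ-≤ᵇ-below a m≤k with skipℕ-cases a
  ... | inj₁ (p , e) rewrite e = refl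
  ... | inj₂ (p , e) rewrite e =
    trans (≤ᵇ-false (ℕ.≤-<-trans m≤k (ℕ.<-trans p ℕ.≤-refl))) (sym (≤ᵇ-false (ℕ.≤-<-trans m≤k p)))

  skipℕ-≤ᵇ-above : ∀ a {m} → k ≤ m → (skipℕ k a ℕ.≤ᵇ suc m) ≡ (a ℕ.≤ᵇ m)
  skipℕ-≤ᵇ-above a k≤m with skipℕ-cases a
  ... | inj₁ (p , e) rewrite e = trans (≤ᵇ-true (ℕ.m≤n⇒m≤1+n (ℕ.≤-trans p k≤m))) (sym (≤ᵇ-true (ℕ.≤-trans p k≤m)))
  ... | inj₂ (p , e) rewrite e = T-ext (ℕ.≤⇒≤ᵇ ∘ ℕ.≤-pred ∘ ℕ.≤ᵇ⇒≤ (suc a) (suc _))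
    (λ t → ℕ.≤⇒≤ᵇ (s≤s (ℕ.≤ᵇ⇒≤ a _ t)))

pre-ins : ∀ k y w i → ∣ y ∣ ≢ i → pre (ins k y w) i ≡ skip k (pre w i)
pre-ins zero    y w       i ne = trans (pre-there y w i ne) (shift≡skip0 (pre w i))
  where
  shift≡skip0 : ∀ z → shift z ≡ skip 0 z
  shift≡skip0 (+ zero)  = refl
  shift≡skip0 (+ suc _) = refl
  shift≡skip0 -[1+ _ ]  = refl
pre-ins (suc k) y []      i ne = pre-there y [] i ne
pre-ins (suc k) y (z ∷ w) i ne rewrite pre-∷ z (ins k y w) i | pre-∷ z w i with z ==ᶻ + i | z ==ᶻ - + i
... | true  | _     = refl
... | false | true  = refl
... | false | false = trans (cong shift (pre-ins k y w i ne)) (shift-skip k (pre w i))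

pre-ins-self : ∀ k x m w → k ≤ length w → All (λ z → ∣ z ∣ ≢ suc m) w →
               pre (ins k (signed x (suc m)) w) (suc m) ≡ signed x (suc k)
pre-ins-self zero    (+ _)    m w _ _ = pre-here⁺ (suc m) w
pre-ins-self zero    -[1+ _ ] m w _ _ = pre-here⁻ (suc m) w (s≤s z≤n)
pre-ins-self (suc k) x m (z ∷ w) (s≤s l) (ne ∷ nes) =
  trans (pre-there z (ins k (signed x (suc m)) w) (suc m) ne) (trans (cong shift (pre-ins-self k x m w l nes)) (shift-signed x))
  where
  shift-signed : ∀ x → shift (signed x (suc k)) ≡ signed x (suc (suc k))
  shift-signed (+ _)    = refl
  shift-signed -[1+ _ ] = refl

module _ {n : ℕ} (c : Code n) (x : ℤ) (x∈ : InR (suc n) x) where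

  private
    k = ∣ x ∣ ∸ 1
    c′ = snoc c x x∈

  suc-pred-∣∣ : suc (∣ x ∣ ∸ 1) ≡ ∣ x ∣
  suc-pred-∣∣ = ℕ.m+[n∸m]≡n (proj₁ x∈)

  pred-∣∣≤ : ∣ x ∣ ∸ 1 ≤ n
  pred-∣∣≤ = ℕ.≤-pred (subst (_≤ suc n) (sym suc-pred-∣∣) (proj₂ x∈))

  pre-α-init : ∀ i → Range n i → pre (α c′) i ≡ skip k (pre (α c) i)
  pre-α-init i (_ , q) = pre-ins k (signed x (suc n)) (α c) i
    (λ e → ℕ.<⇒≱ (s≤s q) (ℕ.≤-reflexive (trans (sym (∣signed∣ x (suc n))) e)))

  pre-α-last : pre (α c′) (suc n) ≡ x
  pre-α-last = begin
    pre (α c′) (suc n)  ≡⟨ pre-ins-self k x n (α c) (subst (k ≤_) (sym (length-α c)) pred-∣∣≤)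
                             (All.map (λ r e → ℕ.<⇒≱ (s≤s (proj₂ r)) (ℕ.≤-reflexive (sym e))) (proj₁ (proj₂ (α-IsB c)))) ⟩
    signed x (suc k)    ≡⟨ cong (signed x) suc-pred-∣∣ ⟩
    signed x ∣ x ∣      ≡⟨ signed-∣∣ x ⟩
    x                   ∎
    where open ≡-Reasoning

  ∣pre-α∣ : ∀ i → Range n i → ∣ pre (α c′) i ∣ ≡ skipℕ k ∣ pre (α c) i ∣
  ∣pre-α∣ i r = trans (cong ∣_∣ (pre-α-init i r)) (∣skip∣ k (pre (α c) i))

-- The positions of the letters `1, …, n` up to sign are `1, …, n` in some order. The induction
-- follows the insertions: if `m < ∣ x ∣`, no place up to `m` changes; otherwise the new letter
-- takes one of these places and the old letters share the other `m ∸ 1`.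
count-pre-α : ∀ {n} (c : Code n) m → m ≤ n → count (λ j → ∣ pre (α c) j ∣ ℕ.≤ᵇ m) (range1 n) ≡ m
count-pre-α ε m m≤n = sym (ℕ.n≤0⇒n≡0 m≤n)
count-pre-α {suc n} c′@(snoc c x x∈) m m≤
  rewrite count-range1-suc (λ j → ∣ pre (α c′) j ∣ ℕ.≤ᵇ m) n | pre-α-last c x x∈
  with ℕ.≤-<-connex ∣ x ∣ m
... | inj₂ m<x = begin
    count (λ j → ∣ pre (α c′) j ∣ ℕ.≤ᵇ m) (range1 n) ℕ.+ 𝟙 (∣ x ∣ ℕ.≤ᵇ m)
      ≡⟨ cong₂ ℕ._+_ (count-cong (All.map (λ {j} r → trans (cong (ℕ._≤ᵇ m) (∣pre-α∣ c x x∈ j r))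
           (skipℕ-≤ᵇ-below _ ∣ pre (α c) j ∣ m≤k)) (All-range1 n))) (cong 𝟙 (≤ᵇ-false m<x)) ⟩
    count (λ j → ∣ pre (α c) j ∣ ℕ.≤ᵇ m) (range1 n) ℕ.+ 0 ≡⟨ ℕ.+-identityʳ _ ⟩
    count (λ j → ∣ pre (α c) j ∣ ℕ.≤ᵇ m) (range1 n) ≡⟨ count-pre-α c m (ℕ.≤-trans m≤k (pred-∣∣≤ c x x∈)) ⟩
    m ∎
  where
  open ≡-Reasoning
  m≤k : m ≤ ∣ x ∣ ∸ 1
  m≤k = ℕ.≤-pred (subst (suc m ≤_) (sym (suc-pred-∣∣ c x x∈)) m<x)
-- Here `m` is at least `∣ x ∣ ≥ 1`, hence a successor, and the old word is counted against its
-- predecessor.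
... | inj₁ x≤m with m | m≤ | x≤m | ℕ.≤-trans (proj₁ x∈) x≤m
...   | suc m′ | s≤s m′≤n | x≤sm′ | _ = begin
    count (λ j → ∣ pre (α c′) j ∣ ℕ.≤ᵇ suc m′) (range1 n) ℕ.+ 𝟙 (∣ x ∣ ℕ.≤ᵇ suc m′)
      ≡⟨ cong₂ ℕ._+_ (count-cong (All.map (λ {j} r → trans (cong (ℕ._≤ᵇ suc m′) (∣pre-α∣ c x x∈ j r))
           (skipℕ-≤ᵇ-above _ ∣ pre (α c) j ∣ k≤m′)) (All-range1 n))) (cong 𝟙 (≤ᵇ-true x≤sm′)) ⟩
    count (λ j → ∣ pre (α c) j ∣ ℕ.≤ᵇ m′) (range1 n) ℕ.+ 1 ≡⟨ ℕ.+-comm _ 1 ⟩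
    suc (count (λ j → ∣ pre (α c) j ∣ ℕ.≤ᵇ m′) (range1 n)) ≡⟨ cong suc (count-pre-α c m′ m′≤n) ⟩
    suc m′ ∎
  where
  open ≡-Reasoning
  k≤m′ : ∣ x ∣ ∸ 1 ≤ m′
  k≤m′ = ℕ.≤-pred (subst (_≤ suc m′) (sym (suc-pred-∣∣ c x x∈)) x≤sm′)

lehEntry : Word → ℕ → ℤ
lehEntry w i = signed (pre w i) (count (λ j → ∣ pre w j ∣ ℕ.≤ᵇ ∣ pre w i ∣) (range1 i))

-- The last entry counts all positions up to `∣ x ∣`, of which there are `∣ x ∣`. An earlier entry
-- only compares positions of letters up to `i`, whose order is untouched by the insertion.
lehEntry-α : ∀ {n} (c : Code n) i → Range n i → lehEntry (α c) i ≡ toList c ! i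
lehEntry-α ε i (p , q) = contradiction (ℕ.≤-trans p q) ℕ.1+n≰n
lehEntry-α {suc n} c′@(snoc c x x∈) i (p , q) with ℕ.m≤n⇒m<n∨m≡n q
... | inj₂ refl rewrite pre-α-last c x x∈ =
  trans (cong (signed x) (count-pre-α c′ ∣ x ∣ (proj₂ x∈))) (trans (signed-∣∣ x) (sym (toList-!-last c x x∈)))
... | inj₁ (s≤s i≤n) = begin
    lehEntry (α c′) i
      ≡⟨ cong₂ signed (pre-α-init c x x∈ i (p , i≤n)) (count-cong (All.map same-order (All-range1 i))) ⟩
    signed (skip k (pre (α c) i)) _ ≡⟨ signed-skip k (pre (α c) i) _ ⟩
    lehEntry (α c) i                ≡⟨ lehEntry-α c i (p , i≤n) ⟩
    toList c ! i                    ≡⟨ toList-!-init c x x∈ i (p , i≤n) ⟨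
    toList c′ ! i                   ∎
  where
  open ≡-Reasoning
  k = ∣ x ∣ ∸ 1
  same-order : ∀ {j} → Range i j → (∣ pre (α c′) j ∣ ℕ.≤ᵇ ∣ pre (α c′) i ∣) ≡ (∣ pre (α c) j ∣ ℕ.≤ᵇ ∣ pre (α c) i ∣)
  same-order {j} (r , s) = trans
    (cong₂ ℕ._≤ᵇ_ (∣pre-α∣ c x x∈ j (r , ℕ.≤-trans s i≤n)) (∣pre-α∣ c x x∈ i (p , i≤n)))
    (skipℕ-≤ᵇ k ∣ pre (α c) j ∣ ∣ pre (α c) i ∣)

Acode-! : ∀ w i → Range (length w) i → Acode w ! i ≡ lehEntry w i
Acode-! w i r = trans (map-range1-! _ i (subst (λ m → Range m i) (sym len) r))
  (cong₂ signed (pre-! i r) (count-cong (All.map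
    (λ {j} (p , q) → cong₂ (λ a b → ∣ a ∣ ℕ.≤ᵇ ∣ b ∣) (pre-! j (p , ℕ.≤-trans q (proj₂ r))) (pre-! i r))
    (All-range1 i))))
  where
  len : length (invWord w) ≡ length w
  len = trans (length-map (pre w) (range1 (length w))) (length-range1 _)
  pre-! : ∀ j → Range (length w) j → invWord w ! j ≡ pre w j
  pre-! = map-range1-! (pre w)

length-Acode : ∀ w → length (Acode w) ≡ length w
length-Acode w = trans (length-map _ (range1 (length (invWord w)))) (trans (length-range1 _)
  (trans (length-map (pre w) (range1 (length w))) (length-range1 _)))

Acode-α : ∀ {n} (c : Code n) → Acode (α c) ≡ toList c
Acode-α c = word-ext _ _ (trans (length-Acode (α c)) (length-α c)) (length-toList c) λ i r →
  trans (Acode-! (α c) i (subst (λ m → Range m i) (sym (length-α c)) r)) (lehEntry-α c i r)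

-- Statistics under insertion

count-range1-∷ : ∀ (p : ℕ → Bool) n → count p (range1 (suc n)) ≡ 𝟙 (p 1) ℕ.+ count (p ∘ suc) (range1 n)
count-range1-∷ p n = trans (cong (count p) (range1-suc n))
  (trans (count-∷ p 1 (map suc (range1 n))) (cong (𝟙 (p 1) ℕ.+_) (count-map p suc (range1 n))))

all-range1-∷ : ∀ (p : ℕ → Bool) n → all p (range1 (suc n)) ≡ p 1 ∧ all (p ∘ suc) (range1 n)
all-range1-∷ p n = trans (cong (all p) (range1-suc n)) (cong (p 1 ∧_) (all-map p suc (range1 n)))

any-range1-∷ : ∀ (p : ℕ → Bool) n → any p (range1 (suc n)) ≡ p 1 ∨ any (p ∘ suc) (range1 n)
any-range1-∷ p n = trans (cong (any p) (range1-suc n)) (cong (p 1 ∨_) (any-map p suc (range1 n)))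

sum-range1-∷ : ∀ (f : ℕ → ℕ) n → sum (map f (range1 (suc n))) ≡ f 1 ℕ.+ sum (map (f ∘ suc) (range1 n))
sum-range1-∷ f n = trans (cong (sum ∘ map f) (range1-suc n)) (cong (λ l → f 1 ℕ.+ sum l) (sym (map-∘ (range1 n))))

count-! : ∀ (p : ℤ → Bool) w → count (λ j → p (w ! j)) (range1 (length w)) ≡ count p w
count-! p w = trans (sym (count-map p (w !_) (range1 (length w)))) (cong (count p) (map-!-range1 w))

all-! : ∀ (p : ℤ → Bool) w → all (λ j → p (w ! j)) (range1 (length w)) ≡ all p w
all-! p w = trans (sym (all-map p (w !_) (range1 (length w)))) (cong (all p) (map-!-range1 w))

any-! : ∀ (p : ℤ → Bool) w → any (λ j → p (w ! j)) (range1 (length w)) ≡ any p w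
any-! p w = trans (sym (any-map p (w !_) (range1 (length w)))) (cong (any p) (map-!-range1 w))

-- The statistics are defined by position indices. Peeling off the first letter turns them into
-- recursions on the word, which is the form in which `ins` can be followed.
module _ (R : ℤ → ℤ → Bool) where

  private
    later : Word → ℕ → ℕ → Bool
    later w i j = (i ℕ.<ᵇ j) ∧ R (w ! i) (w ! j)

    later-head : ∀ x w j → Range (length w) j → later (x ∷ w) 1 (suc j) ≡ R x (w ! j)
    later-head x w (suc j) _ = refl

    later-tail : ∀ x w i j → 1 ≤ i → Range (length w) j → later (x ∷ w) (suc i) (suc j) ≡ later w i j
    later-tail x w (suc i) (suc j) _ _ = refl

  count-later-head : ∀ x w → count (later (x ∷ w) 1) (range1 (suc (length w))) ≡ count (R x) w
  count-later-head x w = trans (count-range1-∷ (later (x ∷ w) 1) (length w))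
    (trans (count-cong (All.map (later-head x w _) (All-range1 (length w)))) (count-! (R x) w))

  count-later-tail : ∀ x w i → 1 ≤ i → count (later (x ∷ w) (suc i)) (range1 (suc (length w))) ≡
                                       count (later w i) (range1 (length w))
  count-later-tail x w i i≥1 = trans (count-range1-∷ (later (x ∷ w) (suc i)) (length w))
    (count-cong (All.map (later-tail x w i _ i≥1) (All-range1 (length w))))

  any-later-head : ∀ x w → any (later (x ∷ w) 1) (range1 (suc (length w))) ≡ any (R x) w
  any-later-head x w = trans (any-range1-∷ (later (x ∷ w) 1) (length w))
    (trans (any-cong (All.map (later-head x w _) (All-range1 (length w)))) (any-! (R x) w))

  any-later-tail : ∀ x w i → 1 ≤ i → any (later (x ∷ w) (suc i)) (range1 (suc (length w))) ≡
                                       any (later w i) (range1 (length w))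
  any-later-tail x w i i≥1 = trans (any-range1-∷ (later (x ∷ w) (suc i)) (length w))
    (any-cong (All.map (later-tail x w i _ i≥1) (All-range1 (length w))))

  private
    from : Word → ℕ → ℕ → Bool
    from w i j = (i ℕ.≤ᵇ j) ∧ R (w ! i) (w ! j)

  count-from-head : ∀ x w → count (from (x ∷ w) 1) (range1 (suc (length w))) ≡ count (R x) (x ∷ w)
  count-from-head x w = trans (count-range1-∷ (from (x ∷ w) 1) (length w))
    (trans (cong (𝟙 (R x x) ℕ.+_) (trans (count-cong (All.map (from-head _) (All-range1 (length w)))) (count-! (R x) w)))
           (sym (count-∷ (R x) x w)))
    where
    from-head : ∀ j → Range (length w) j → from (x ∷ w) 1 (suc j) ≡ R x (w ! j)
    from-head (suc j) _ = refl

  count-from-tail : ∀ x w i → 1 ≤ i → count (from (x ∷ w) (suc i)) (range1 (suc (length w))) ≡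
                                      count (from w i) (range1 (length w))
  count-from-tail x w (suc i) i≥1 = trans (count-range1-∷ (from (x ∷ w) (suc (suc i))) (length w))
    (count-cong (All.map (from-tail _) (All-range1 (length w))))
    where
    from-tail : ∀ j → Range (length w) j → from (x ∷ w) (suc (suc i)) (suc j) ≡ from w (suc i) j
    from-tail (suc j) _ = refl

-- The second count includes `x` itself because pairs with `i = j` are allowed; that pair
-- contributes exactly when `x` is negative.
invB-∷ : ∀ x w → invB (x ∷ w) ≡ count (_<ᶻ x) w ℕ.+ count (_<ᶻ (- x)) (x ∷ w) ℕ.+ invB w
invB-∷ x w = trans (sum-range1-∷ _ (length w)) (cong₂ ℕ._+_
  (cong₂ ℕ._+_ (count-later-head (λ a b → b <ᶻ a) x w) (count-from-head (λ a b → b <ᶻ (- a)) x w))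
  (cong sum (range1-map-cong (length w) λ i r →
    cong₂ ℕ._+_ (count-later-tail (λ a b → b <ᶻ a) x w i (proj₁ r)) (count-from-tail (λ a b → b <ᶻ (- a)) x w i (proj₁ r)))))

isDescent : Word → ℕ → Bool
isDescent w i = any (λ j → (i ℕ.<ᵇ j) ∧ ((+ ∣ w ! j ∣) <ᶻ w ! i)) (range1 (length w))

descents : Word → ℕ
descents w = count (isDescent w) (range1 (length w))

descents-∷ : ∀ x w → descents (x ∷ w) ≡ 𝟙 (any (λ z → + ∣ z ∣ <ᶻ x) w) ℕ.+ descents w
descents-∷ x w = trans (count-range1-∷ (isDescent (x ∷ w)) (length w)) (cong₂ ℕ._+_
  (cong 𝟙 (any-later-head (λ a b → (+ ∣ b ∣) <ᶻ a) x w))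
  (count-cong (All.map (λ {i} r → any-later-tail (λ a b → (+ ∣ b ∣) <ᶻ a) x w i (proj₁ r)) (All-range1 (length w)))))

isRmil-∷ : ∀ x w v → isRmil (x ∷ w) v ≡ ((x ==ᶻ + v) ∧ (+ 0 <ᶻ x) ∧ all (λ z → x <ᶻ + ∣ z ∣) w) ∨ isRmil w v
isRmil-∷ x w v = trans (any-range1-∷ _ (length w)) (cong₂ _∨_
  (cong (λ b → (x ==ᶻ + v) ∧ (+ 0 <ᶻ x) ∧ b)
    (trans (all-range1-∷ (λ j → not (1 ℕ.<ᵇ j) ∨ (x <ᶻ + ∣ (x ∷ w) ! j ∣)) (length w)) (trans (all-cong (All.map (head _) (All-range1 (length w)))) (all-! (λ z → x <ᶻ + ∣ z ∣) w))))
  (any-cong (All.map (λ {i} r → tail i (proj₁ r)) (All-range1 (length w)))))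
  where
  head : ∀ j → Range (length w) j → (not (1 ℕ.<ᵇ suc j) ∨ (x <ᶻ + ∣ (x ∷ w) ! suc j ∣)) ≡ (x <ᶻ + ∣ w ! j ∣)
  head (suc j) _ = refl
  entry : Word → ℕ → Bool
  entry u i = (u ! i ==ᶻ + v) ∧ (+ 0 <ᶻ u ! i)
              ∧ all (λ j → not (i ℕ.<ᵇ j) ∨ (u ! i <ᶻ + ∣ u ! j ∣)) (range1 (length u))
  tail : ∀ i → 1 ≤ i → entry (x ∷ w) (suc i) ≡ entry w i
  tail (suc i) _ = cong (λ b → (w ! suc i ==ᶻ + v) ∧ (+ 0 <ᶻ w ! suc i) ∧ b)
    (trans (all-range1-∷ (λ j → not (suc (suc i) ℕ.<ᵇ j) ∨ (w ! suc i <ᶻ + ∣ (x ∷ w) ! j ∣)) (length w)) (all-cong (All.map (beyond _) (All-range1 (length w)))))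
    where
    beyond : ∀ j → Range (length w) j → (not (suc (suc i) ℕ.<ᵇ suc j) ∨ (w ! suc i <ᶻ + ∣ (x ∷ w) ! suc j ∣))
                                      ≡ (not (suc i ℕ.<ᵇ j) ∨ (w ! suc i <ᶻ + ∣ w ! j ∣))
    beyond (suc j) _ = refl

<ᶻ-true : ∀ {x y} → x ℤ.< y → (x <ᶻ y) ≡ true
<ᶻ-true {x} {y} = isYes-true (x ℤ.<? y)

<ᶻ-false : ∀ {x y} → y ℤ.≤ x → (x <ᶻ y) ≡ false
<ᶻ-false {x} {y} y≤x = isYes-false (x ℤ.<? y) (ℤ.≤⇒≯ y≤x)

≤∣∣ : ∀ z → z ℤ.≤ + ∣ z ∣
≤∣∣ (+ n)    = ℤ.≤-refl
≤∣∣ -[1+ n ] = ℤ.-≤+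

-∣∣≤ : ∀ z → - + ∣ z ∣ ℤ.≤ z
-∣∣≤ z = subst (- + ∣ z ∣ ℤ.≤_) (ℤ.neg-involutive z)
  (ℤ.neg-mono-≤ (subst (λ m → - z ℤ.≤ + m) (ℤ.∣-i∣≡∣i∣ z) (≤∣∣ (- z))))

module _ {z : ℤ} {m : ℕ} (∣z∣<m : ∣ z ∣ < m) where

  ∣∣<⇒< : z ℤ.< + m
  ∣∣<⇒< = ℤ.≤-<-trans (≤∣∣ z) (ℤ.+<+ ∣z∣<m)

  ∣∣<⇒-< : - + m ℤ.< z
  ∣∣<⇒-< = ℤ.<-≤-trans (ℤ.neg-mono-< (ℤ.+<+ ∣z∣<m)) (-∣∣≤ z)

count-ins : ∀ (p : ℤ → Bool) k y w → count p (ins k y w) ≡ 𝟙 (p y) ℕ.+ count p w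
count-ins p zero    y w       = count-∷ p y w
count-ins p (suc k) y []      = count-∷ p y []
count-ins p (suc k) y (z ∷ w) = begin
  count p (z ∷ ins k y w)                   ≡⟨ count-∷ p z (ins k y w) ⟩
  𝟙 (p z) ℕ.+ count p (ins k y w)           ≡⟨ cong (𝟙 (p z) ℕ.+_) (count-ins p k y w) ⟩
  𝟙 (p z) ℕ.+ (𝟙 (p y) ℕ.+ count p w)       ≡⟨ ℕ.+-assoc (𝟙 (p z)) _ _ ⟨
  𝟙 (p z) ℕ.+ 𝟙 (p y) ℕ.+ count p w         ≡⟨ cong (ℕ._+ count p w) (ℕ.+-comm (𝟙 (p z)) _) ⟩
  𝟙 (p y) ℕ.+ 𝟙 (p z) ℕ.+ count p w         ≡⟨ ℕ.+-assoc (𝟙 (p y)) _ _ ⟩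
  𝟙 (p y) ℕ.+ (𝟙 (p z) ℕ.+ count p w)       ≡⟨ cong (𝟙 (p y) ℕ.+_) (count-∷ p z w) ⟨
  𝟙 (p y) ℕ.+ count p (z ∷ w)               ∎
  where open ≡-Reasoning

all-ins : ∀ (p : ℤ → Bool) k y w → p y ≡ true → all p (ins k y w) ≡ all p w
all-ins p zero    y w       e rewrite e = refl
all-ins p (suc k) y []      e rewrite e = refl
all-ins p (suc k) y (z ∷ w) e = cong (p z ∧_) (all-ins p k y w e)

any-ins : ∀ (p : ℤ → Bool) k y w → p y ≡ false → any p (ins k y w) ≡ any p w
any-ins p zero    y w       e rewrite e = refl
any-ins p (suc k) y []      e rewrite e = refl
any-ins p (suc k) y (z ∷ w) e = cong (p z ∨_) (any-ins p k y w e)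

Below : ℕ → Word → Set
Below m = All (λ z → ∣ z ∣ < m)

module _ {m : ℕ} where

  -- As `m` exceeds all other absolute values, `+ m` forms one ordinary inversion with each letter
  -- to its right and no other pair.
  invB-ins⁺ : ∀ k w → Below m w → k ≤ length w → invB (ins k (+ m) w) ≡ invB w ℕ.+ (length w ∸ k)
  invB-ins⁺ zero w b _ = begin
    invB (+ m ∷ w)
      ≡⟨ invB-∷ (+ m) w ⟩
    count (_<ᶻ + m) w ℕ.+ count (_<ᶻ (- + m)) (+ m ∷ w) ℕ.+ invB w
      ≡⟨ cong (ℕ._+ invB w) (cong₂ ℕ._+_ (count-true (All.map (λ l → <ᶻ-true (∣∣<⇒< l)) b))
           (count-false {p = _<ᶻ (- + m)} {xs = + m ∷ w} (<ᶻ-false (ℤ.neg-≤-pos {m}) ∷ All.map (λ l → <ᶻ-false (ℤ.<⇒≤ (∣∣<⇒-< l))) b))) ⟩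
    length w ℕ.+ 0 ℕ.+ invB w  ≡⟨ cong (ℕ._+ invB w) (ℕ.+-identityʳ (length w)) ⟩
    length w ℕ.+ invB w        ≡⟨ ℕ.+-comm (length w) _ ⟩
    invB w ℕ.+ length w        ∎
    where open ≡-Reasoning
  invB-ins⁺ (suc k) (z ∷ w) (b ∷ bs) (s≤s l) = begin
    invB (z ∷ ins k (+ m) w)
      ≡⟨ invB-∷ z (ins k (+ m) w) ⟩
    count (_<ᶻ z) (ins k (+ m) w) ℕ.+ count (_<ᶻ (- z)) (ins (suc k) (+ m) (z ∷ w)) ℕ.+ invB (ins k (+ m) w)
      ≡⟨ cong₂ ℕ._+_ (cong₂ ℕ._+_
           (trans (count-ins (_<ᶻ z) k (+ m) w) (cong (λ c → 𝟙 c ℕ.+ count (_<ᶻ z) w) (<ᶻ-false (ℤ.<⇒≤ (∣∣<⇒< b)))))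
           (trans (count-ins (_<ᶻ (- z)) (suc k) (+ m) (z ∷ w)) (cong (λ c → 𝟙 c ℕ.+ count (_<ᶻ (- z)) (z ∷ w))
             (<ᶻ-false (ℤ.<⇒≤ (∣∣<⇒< { - z} (subst (_< m) (sym (ℤ.∣-i∣≡∣i∣ z)) b)))))))
           (invB-ins⁺ k w bs l) ⟩
    count (_<ᶻ z) w ℕ.+ count (_<ᶻ (- z)) (z ∷ w) ℕ.+ (invB w ℕ.+ (length w ∸ k))
      ≡⟨ ℕ.+-assoc (count (_<ᶻ z) w ℕ.+ count (_<ᶻ (- z)) (z ∷ w)) (invB w) (length w ∸ k) ⟨
    count (_<ᶻ z) w ℕ.+ count (_<ᶻ (- z)) (z ∷ w) ℕ.+ invB w ℕ.+ (length w ∸ k)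
      ≡⟨ cong (ℕ._+ (length w ∸ k)) (invB-∷ z w) ⟨
    invB (z ∷ w) ℕ.+ (length w ∸ k) ∎
    where open ≡-Reasoning

  -- Each of the `k` letters to the left of `- m` gives two pairs, one of each kind; `- m` gives one
  -- with itself and one with each letter to its right. The total is `2k + 1 + (length w - k)`.
  invB-ins⁻ : ∀ k w → Below m w → 1 ≤ m → k ≤ length w → invB (ins k (- + m) w) ≡ invB w ℕ.+ (length w ℕ.+ suc k)
  invB-ins⁻ zero w b m≥1 _ = begin
    invB (- + m ∷ w)
      ≡⟨ invB-∷ (- + m) w ⟩
    count (_<ᶻ (- + m)) w ℕ.+ count (_<ᶻ (- - + m)) (- + m ∷ w) ℕ.+ invB w
      ≡⟨ cong (λ y → count (_<ᶻ (- + m)) w ℕ.+ count (_<ᶻ y) (- + m ∷ w) ℕ.+ invB w) (ℤ.neg-involutive (+ m)) ⟩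
    count (_<ᶻ (- + m)) w ℕ.+ count (_<ᶻ + m) (- + m ∷ w) ℕ.+ invB w
      ≡⟨ cong (ℕ._+ invB w) (cong₂ ℕ._+_ (count-false (All.map (λ l → <ᶻ-false (ℤ.<⇒≤ (∣∣<⇒-< l))) b))
           (count-true {p = _<ᶻ + m} {xs = - + m ∷ w} (<ᶻ-true (-m<m m≥1) ∷ All.map (λ l → <ᶻ-true (∣∣<⇒< l)) b))) ⟩
    suc (length w) ℕ.+ invB w     ≡⟨ ℕ.+-comm (suc (length w)) (invB w) ⟩
    invB w ℕ.+ suc (length w)     ≡⟨ cong (invB w ℕ.+_) (ℕ.+-comm 1 (length w)) ⟩
    invB w ℕ.+ (length w ℕ.+ 1)   ∎
    where
    open ≡-Reasoning
    -m<m : ∀ {m} → 1 ≤ m → - + m ℤ.< + m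
    -m<m (s≤s _) = ℤ.-<+
  invB-ins⁻ (suc k) (z ∷ w) (b ∷ bs) m≥1 (s≤s l) = begin
    invB (z ∷ ins k (- + m) w)
      ≡⟨ invB-∷ z (ins k (- + m) w) ⟩
    count (_<ᶻ z) (ins k (- + m) w) ℕ.+ count (_<ᶻ (- z)) (ins (suc k) (- + m) (z ∷ w)) ℕ.+ invB (ins k (- + m) w)
      ≡⟨ cong₂ ℕ._+_ (cong₂ ℕ._+_
           (trans (count-ins (_<ᶻ z) k (- + m) w) (cong (λ c → 𝟙 c ℕ.+ count (_<ᶻ z) w) (<ᶻ-true (∣∣<⇒-< b))))
           (trans (count-ins (_<ᶻ (- z)) (suc k) (- + m) (z ∷ w)) (cong (λ c → 𝟙 c ℕ.+ count (_<ᶻ (- z)) (z ∷ w))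
             (<ᶻ-true (∣∣<⇒-< { - z} (subst (_< m) (sym (ℤ.∣-i∣≡∣i∣ z)) b))))))
           (invB-ins⁻ k w bs m≥1 l) ⟩
    suc p ℕ.+ suc q ℕ.+ (invB w ℕ.+ (length w ℕ.+ suc k))
      ≡⟨ rearrange p q (invB w) (length w) k ⟩
    p ℕ.+ q ℕ.+ invB w ℕ.+ (suc (length w) ℕ.+ suc (suc k))
      ≡⟨ cong (ℕ._+ (suc (length w) ℕ.+ suc (suc k))) (invB-∷ z w) ⟨
    invB (z ∷ w) ℕ.+ (suc (length w) ℕ.+ suc (suc k)) ∎
    where
    open ≡-Reasoning
    p = count (_<ᶻ z) w
    q = count (_<ᶻ (- z)) (z ∷ w)
    rearrange : ∀ p q r s k → suc p ℕ.+ suc q ℕ.+ (r ℕ.+ (s ℕ.+ suc k)) ≡ p ℕ.+ q ℕ.+ r ℕ.+ (suc s ℕ.+ suc (suc k))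
    rearrange = solve-∀

  isRmil-ins : ∀ k y w v → ∣ y ∣ ≡ m → Below m w → v ≢ m → isRmil (ins k y w) v ≡ isRmil w v
  isRmil-ins zero    y w v e b ne = trans (isRmil-∷ y w v)
    (cong (λ c → (c ∧ (+ 0 <ᶻ y) ∧ all (λ z → y <ᶻ + ∣ z ∣) w) ∨ isRmil w v)
      (isYes-false (y ℤ.≟ + v) (λ y≡v → ne (trans (cong ∣_∣ (sym y≡v)) e))))
  isRmil-ins (suc k) y [] v e b ne = isRmil-ins zero y [] v e b ne
  isRmil-ins (suc k) y (z ∷ w) v refl (b ∷ bs) ne = begin
    isRmil (z ∷ ins k y w) v ≡⟨ isRmil-∷ z (ins k y w) v ⟩
    ((z ==ᶻ + v) ∧ (+ 0 <ᶻ z) ∧ all (λ u → z <ᶻ + ∣ u ∣) (ins k y w)) ∨ isRmil (ins k y w) v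
      ≡⟨ cong₂ (λ c d → ((z ==ᶻ + v) ∧ (+ 0 <ᶻ z) ∧ c) ∨ d)
           (all-ins (λ u → z <ᶻ + ∣ u ∣) k y w (<ᶻ-true (∣∣<⇒< b))) (isRmil-ins k y w v refl bs ne) ⟩
    ((z ==ᶻ + v) ∧ (+ 0 <ᶻ z) ∧ all (λ u → z <ᶻ + ∣ u ∣) w) ∨ isRmil w v ≡⟨ isRmil-∷ z w v ⟨
    isRmil (z ∷ w) v ∎
    where open ≡-Reasoning

  isRmil-below : ∀ w → Below m w → isRmil w m ≡ false
  isRmil-below []      []       = refl
  isRmil-below (z ∷ w) (b ∷ bs) = trans (isRmil-∷ z w m) (cong₂ (λ c d → (c ∧ (+ 0 <ᶻ z) ∧ all (λ u → z <ᶻ + ∣ u ∣) w) ∨ d)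
    (isYes-false (z ℤ.≟ + m) (λ e → ℕ.<⇒≢ b (cong ∣_∣ e))) (isRmil-below w bs))

  -- Every letter after `y` has smaller absolute value, so `y` can qualify only as a positive letter
  -- in last place.
  isRmil-ins-max : ∀ k y w → ∣ y ∣ ≡ m → 1 ≤ m → Below m w → k ≤ length w →
                   isRmil (ins k y w) m ≡ (y ==ᶻ + m) ∧ (k ℕ.≡ᵇ length w)
  isRmil-ins-max zero y w _ m≥1 b _ rewrite isRmil-∷ y w m | isRmil-below w b with y ℤ.≟ + m
  ... | no _     = refl
  ... | yes refl rewrite <ᶻ-true (ℤ.+<+ m≥1) with w | b
  ...   | []    | _     = refl
  ...   | z ∷ _ | l ∷ _ rewrite <ᶻ-false (ℤ.<⇒≤ (ℤ.+<+ l)) = refl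
  isRmil-ins-max (suc k) y (z ∷ w) e m≥1 (b ∷ bs) (s≤s l) = trans (isRmil-∷ z (ins k y w) m)
    (trans (cong (λ c → (c ∧ (+ 0 <ᶻ z) ∧ all (λ u → z <ᶻ + ∣ u ∣) (ins k y w)) ∨ isRmil (ins k y w) m)
      (isYes-false (z ℤ.≟ + m) (λ e → ℕ.<⇒≢ b (cong ∣_∣ e)))) (isRmil-ins-max k y w e m≥1 bs l))

  descents-ins⁺ : ∀ k w → Below m w → k ≤ length w →
                  descents (ins k (+ m) w) ≡ descents w ℕ.+ 𝟙 (not (k ℕ.≡ᵇ length w))
  descents-ins⁺ zero [] _ _ = refl
  descents-ins⁺ zero (z ∷ w) (b ∷ bs) _ rewrite descents-∷ (+ m) (z ∷ w) | <ᶻ-true (ℤ.+<+ b) =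
    ℕ.+-comm 1 (descents (z ∷ w))
  descents-ins⁺ (suc k) (z ∷ w) (b ∷ bs) (s≤s l)
    rewrite descents-∷ z (ins k (+ m) w) | descents-∷ z w
          | any-ins (λ u → + ∣ u ∣ <ᶻ z) k (+ m) w (<ᶻ-false (ℤ.<⇒≤ (∣∣<⇒< b)))
          | descents-ins⁺ k w bs l =
    sym (ℕ.+-assoc (𝟙 (any (λ u → + ∣ u ∣ <ᶻ z) w)) (descents w) _)

  descents-ins⁻ : ∀ k w → Below m w → 1 ≤ m → k ≤ length w → descents (ins k (- + m) w) ≡ descents w
  descents-ins⁻ zero w b m≥1 _ = trans (descents-∷ (- + m) w) (cong (λ c → 𝟙 c ℕ.+ descents w) (none w))
    where
    none : ∀ w → any (λ z → + ∣ z ∣ <ᶻ (- + m)) w ≡ false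
    none []      = refl
    none (z ∷ w) = cong₂ _∨_ (<ᶻ-false { + ∣ z ∣} { - + m} (ℤ.neg-≤-pos {m})) (none w)
  descents-ins⁻ (suc k) (z ∷ w) (b ∷ bs) m≥1 (s≤s l)
    rewrite descents-∷ z (ins k (- + m) w) | descents-∷ z w
          | any-ins (λ u → + ∣ u ∣ <ᶻ z) k (- + m) w
              (<ᶻ-false (subst (λ a → z ℤ.≤ + a) (sym (ℤ.∣-i∣≡∣i∣ (+ m))) (ℤ.<⇒≤ (∣∣<⇒< b))))
          | descents-ins⁻ k w bs m≥1 l = refl

-- The weight `j - i - χ(i < 0)` at `j = N`, `i = x`, uniformly for the three kinds of reflection.
-- It vanishes at `x = N`, where the swap is the identity.
cost : ℕ → ℤ → ℕ
cost N (+ m)     = N ∸ m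
cost N -[1+ m ]  = N ℕ.+ suc m ∸ 1

wt : ∀ {n} → Code n → ℕ
wt ε                = 0
wt (snoc {n} c x _) = wt c ℕ.+ cost (suc n) x

ℓ : ∀ {n} → Code n → ℕ
ℓ ε                 = 0
ℓ (snoc {n} c x _)  = ℓ c ℕ.+ 𝟙 (not (x ==ᶻ + suc n))

α-Below : ∀ {n} (c : Code n) → Below (suc n) (α c)
α-Below c = All.map (s≤s ∘ proj₂) (proj₁ (proj₂ (α-IsB c)))

module _ {n : ℕ} (c : Code n) (x : ℤ) (x∈ : InR (suc n) x) where

  private
    k≤ : ∣ x ∣ ∸ 1 ≤ length (α c)
    k≤ = subst (_ ≤_) (sym (length-α c)) (pred-∣∣≤ c x x∈)

  signed-==ᶻ : (signed x (suc n) ==ᶻ + suc n) ∧ (∣ x ∣ ∸ 1 ℕ.≡ᵇ length (α c)) ≡ (x ==ᶻ + suc n)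
  signed-==ᶻ rewrite length-α c = by-sign x (proj₁ x∈)
    where
    by-sign : ∀ x → 1 ≤ ∣ x ∣ → (signed x (suc n) ==ᶻ + suc n) ∧ (∣ x ∣ ∸ 1 ℕ.≡ᵇ n) ≡ (x ==ᶻ + suc n)
    by-sign (+ suc k) _ rewrite isYes-true (+ suc n ℤ.≟ + suc n) refl with k ℕ.≟ n
    ... | yes refl = trans (≡ᵇ-true {k} refl) (sym (isYes-true (+ suc k ℤ.≟ + suc k) refl))
    ... | no ne    = trans (≡ᵇ-false ne) (sym (isYes-false (+ suc k ℤ.≟ + suc n) (ne ∘ ℕ.suc-injective ∘ ℤ.+-injective)))
    by-sign -[1+ k ]  _ = refl

  invB-α-snoc : invB (α (snoc c x x∈)) ≡ invB (α c) ℕ.+ cost (suc n) x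
  invB-α-snoc = trans (by-sign x k≤ (proj₁ x∈)) (cong (λ l → invB (α c) ℕ.+ cost (suc l) x) (length-α c))
    where
    by-sign : ∀ x → ∣ x ∣ ∸ 1 ≤ length (α c) → 1 ≤ ∣ x ∣ →
              invB (ins (∣ x ∣ ∸ 1) (signed x (suc n)) (α c)) ≡ invB (α c) ℕ.+ cost (suc (length (α c))) x
    by-sign (+ suc k) l _ = invB-ins⁺ k (α c) (α-Below c) l
    by-sign -[1+ k ]  l _ = invB-ins⁻ k (α c) (α-Below c) (s≤s z≤n) l

  -- A positive largest letter adds a descent unless it is last. A negative one adds no descent but
  -- is itself a negative entry. Only the positive letter in last place, which is `x = n + 1`, is
  -- free.
  nmin-α-snoc : nmin (α (snoc c x x∈)) ≡ nmin (α c) ℕ.+ 𝟙 (not (x ==ᶻ + suc n))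
  nmin-α-snoc = trans (by-sign x k≤ (proj₁ x∈)) (cong (λ b → nmin (α c) ℕ.+ 𝟙 (not b)) signed-==ᶻ)
    where
    d = descents (α c)
    swap-last : ∀ a b c → a ℕ.+ b ℕ.+ c ≡ a ℕ.+ c ℕ.+ b
    swap-last = solve-∀
    by-sign : ∀ x → ∣ x ∣ ∸ 1 ≤ length (α c) → 1 ≤ ∣ x ∣ →
              nmin (ins (∣ x ∣ ∸ 1) (signed x (suc n)) (α c)) ≡
              nmin (α c) ℕ.+ 𝟙 (not ((signed x (suc n) ==ᶻ + suc n) ∧ (∣ x ∣ ∸ 1 ℕ.≡ᵇ length (α c))))
    by-sign (+ suc k) l _
      rewrite isYes-true (+ suc n ℤ.≟ + suc n) refl
            | count-ins isNeg k (+ suc n) (α c) =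
      trans (cong (ℕ._+ count isNeg (α c)) (descents-ins⁺ k (α c) (α-Below c) l))
            (swap-last d _ (count isNeg (α c)))
    by-sign -[1+ k ] l _
      rewrite count-ins isNeg k (- + suc n) (α c) =
      trans (cong (ℕ._+ suc (count isNeg (α c))) (descents-ins⁻ k (α c) (α-Below c) (s≤s z≤n) l))
            (trans (sym (ℕ.+-assoc d 1 _)) (swap-last d 1 (count isNeg (α c))))

  isRmil-α-init : ∀ v → v ≤ n → isRmil (α (snoc c x x∈)) v ≡ isRmil (α c) v
  isRmil-α-init v v≤n = isRmil-ins (∣ x ∣ ∸ 1) _ (α c) v (∣signed∣ x (suc n)) (α-Below c) (ℕ.<⇒≢ (s≤s v≤n))

  isRmil-α-last : isRmil (α (snoc c x x∈)) (suc n) ≡ (x ==ᶻ + suc n)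
  isRmil-α-last = trans (isRmil-ins-max (∣ x ∣ ∸ 1) _ (α c) (∣signed∣ x (suc n)) (s≤s z≤n) (α-Below c) k≤) signed-==ᶻ

invB-α : ∀ {n} (c : Code n) → invB (α c) ≡ wt c
invB-α ε           = refl
invB-α (snoc c x r) = trans (invB-α-snoc c x r) (cong (ℕ._+ _) (invB-α c))

nmin-α : ∀ {n} (c : Code n) → nmin (α c) ≡ ℓ c
nmin-α ε           = refl
nmin-α (snoc c x r) = trans (nmin-α-snoc c x r) (cong (ℕ._+ _) (nmin-α c))

-- Lmap and cycles

isLmap : Word → ℕ → Bool
isLmap w i = all (λ j → (+ ∣ w ! j ∣) <ᶻ w ! i) (range1 (i ∸ 1))

-- The common core of the two growth steps: both keep the letters left of `∣ x ∣` and put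
-- `± (n + 1)` at `∣ x ∣`. To the right they differ, but there the letter at `∣ x ∣` dominates
-- everything, so no position qualifies.
module _ {n : ℕ} (x : ℤ) (x∈ : InR (suc n) x) (w w′ : Word) (b′ : IsB (suc n) w′)
         (agree : ∀ j → 1 ≤ j → j < ∣ x ∣ → w′ ! j ≡ w ! j)
         (at : w′ ! ∣ x ∣ ≡ signed x (suc n)) where

  private
    small : ∀ j → Range (suc n) j → j ≢ ∣ x ∣ → ∣ w′ ! j ∣ ≤ n
    small j r ne = proj₂ (∣∣-≤suc {z = w′ ! j} (IsB-range b′ j r) λ e →
      ne (IsB-injective b′ j ∣ x ∣ r x∈ (trans e (sym (trans (cong ∣_∣ at) (∣signed∣ x (suc n)))))))

    before : ∀ {i j} → Range (i ∸ 1) j → j < i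
    before {zero}  (p , q) = contradiction (ℕ.≤-trans p q) ℕ.1+n≰n
    before {suc i} (_ , q) = s≤s q

  isLmap-below : ∀ i → 1 ≤ i → i < ∣ x ∣ → isLmap w′ i ≡ isLmap w i
  isLmap-below i p q = all-cong (All.map
    (λ {j} r → cong₂ (λ a b → (+ ∣ a ∣) <ᶻ b) (agree j (proj₁ r) (ℕ.<-trans (before r) q)) (agree i p q)) (All-range1 (i ∸ 1)))

  -- For i = 1 the left side is `true` even if x is negative: nothing precedes the first letter.
  isLmap-at : isLmap w′ ∣ x ∣ ≡ all (λ _ → not (isNeg x)) (range1 (∣ x ∣ ∸ 1))
  isLmap-at = all-cong (All.map (λ {j} r → trans (cong ((+ ∣ w′ ! j ∣) <ᶻ_) at)
      (by-sign x (small j (proj₁ r , ℕ.<⇒≤ (ℕ.<-≤-trans (before r) (proj₂ x∈))) (ℕ.<⇒≢ (before r))))) (All-range1 (∣ x ∣ ∸ 1)))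
    where
    by-sign : ∀ x {m} → m ≤ n → (+ m <ᶻ signed x (suc n)) ≡ not (isNeg x)
    by-sign (+ _)    l = <ᶻ-true (ℤ.+<+ (s≤s l))
    by-sign -[1+ _ ] l = refl

  isLmap-above : ∀ i → ∣ x ∣ < i → i ≤ suc n → isLmap w′ i ≡ false
  isLmap-above i p q = ¬T⇒≡ λ t → ℤ.<⇒≱ (ℤ.+<+ (s≤s (small i (ℕ.≤-trans (s≤s z≤n) p , q) (ℕ.<⇒≢ p ∘ sym))))
    (ℤ.≤-trans (ℤ.<⇒≤ (subst (λ m → + m ℤ.< w′ ! i) (trans (cong ∣_∣ at) (∣signed∣ x (suc n)))
      (toWitness (All.lookup (All.all⁺ _ _ t) (∈-range1 {i ∸ 1} (proj₁ x∈ , ℕ.≤-pred (subst (suc ∣ x ∣ ≤_) (sym (ℕ.m+[n∸m]≡n {1} (ℕ.≤-trans (s≤s z≤n) p))) p)))))))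
      (≤∣∣ (w′ ! i)))

ins-!-before : ∀ k y w i → 1 ≤ i → i < suc k → k ≤ length w → ins k y w ! i ≡ w ! i
ins-!-before zero    y w       1             _ (s≤s ()) _
ins-!-before zero    y w       (suc (suc i)) _ (s≤s ()) _
ins-!-before (suc k) y []      i             _ _ ()
ins-!-before (suc k) y (z ∷ w) 1             _ _       _       = refl
ins-!-before (suc k) y (z ∷ w) (suc (suc i)) _ (s≤s p) (s≤s l) = ins-!-before k y w (suc i) (s≤s z≤n) p l

ins-!-at : ∀ k y w → k ≤ length w → ins k y w ! suc k ≡ y
ins-!-at zero    y w       _       = refl
ins-!-at (suc k) y (z ∷ w) (s≤s l) = ins-!-at k y w l

module _ {n : ℕ} (c : Code n) (x : ℤ) (x∈ : InR (suc n) x) where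

  private
    c′ = snoc c x x∈
    N : ℤ
    N = + suc n

  α-agree : ∀ j → 1 ≤ j → j < ∣ x ∣ → α c′ ! j ≡ α c ! j
  α-agree j p q = ins-!-before (∣ x ∣ ∸ 1) _ (α c) j p (subst (j <_) (sym (suc-pred-∣∣ c x x∈)) q)
    (subst (_ ≤_) (sym (length-α c)) (pred-∣∣≤ c x x∈))

  α-at : α c′ ! ∣ x ∣ ≡ signed x (suc n)
  α-at = subst (λ m → α c′ ! m ≡ signed x (suc n)) (suc-pred-∣∣ c x x∈)
    (ins-!-at (∣ x ∣ ∸ 1) _ (α c) (subst (_ ≤_) (sym (length-α c)) (pred-∣∣≤ c x x∈)))

  φ-agree : ∀ j → Range n j → j ≢ ∣ x ∣ → φ c′ ! j ≡ φ c ! j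
  φ-agree j r@(p , q) ne = begin
    φ c′ ! j              ≡⟨ φ-! c′ j (p , ℕ.m≤n⇒m≤1+n q) ⟩
    Φ c (swap x N (+ j))  ≡⟨ cong (Φ c) (swap-other x N (+ j) ne (ℕ.<⇒≢ (s≤s q))) ⟩
    Φ c (+ j)             ≡⟨ φ-! c j r ⟨
    φ c ! j               ∎
    where open ≡-Reasoning

  φ-at : φ c′ ! ∣ x ∣ ≡ signed x (suc n)
  φ-at = trans (φ-! c′ ∣ x ∣ x∈) (by-sign x (proj₁ x∈))
    where
    by-sign : ∀ x → 1 ≤ ∣ x ∣ → Φ c (swap x N (+ ∣ x ∣)) ≡ signed x (suc n)
    by-sign (+ k)     _ = trans (cong (Φ c) (swap-fst (+ k) N)) (Φ-fixes c N ℕ.≤-refl)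
    by-sign -[1+ k ]  _ = trans (cong (Φ c) (swap-neg-fst -[1+ k ] N (s≤s z≤n))) (Φ-fixes c (- N) ℕ.≤-refl)

  φ-last : φ c′ ! suc n ≡ Φ c x
  φ-last = trans (φ-! c′ (suc n) (s≤s z≤n , ℕ.≤-refl)) (cong (Φ c) (swap-snd x N))

isLmap-α-φ : ∀ {n} (c : Code n) i → Range n i → isLmap (α c) i ≡ isLmap (φ c) i
isLmap-α-φ ε i (p , q) = contradiction (ℕ.≤-trans p q) ℕ.1+n≰n
isLmap-α-φ {suc n} c′@(snoc c x x∈) i (p , q) = by-position (ℕ.<-cmp i ∣ x ∣)
  where
  φ-agree-below : ∀ j → 1 ≤ j → j < ∣ x ∣ → φ c′ ! j ≡ φ c ! j
  φ-agree-below j r s = φ-agree c x x∈ j (r , ℕ.≤-pred (ℕ.≤-trans s (proj₂ x∈))) (ℕ.<⇒≢ s)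
  by-position : Tri (i < ∣ x ∣) (i ≡ ∣ x ∣) (∣ x ∣ < i) → isLmap (α c′) i ≡ isLmap (φ c′) i
  by-position (tri< i<x _ _) = begin
    isLmap (α c′) i  ≡⟨ isLmap-below x x∈ (α c) _ (α-IsB c′) (α-agree c x x∈) (α-at c x x∈) i p i<x ⟩
    isLmap (α c) i   ≡⟨ isLmap-α-φ c i (p , ℕ.≤-pred (ℕ.≤-trans i<x (proj₂ x∈))) ⟩
    isLmap (φ c) i   ≡⟨ isLmap-below x x∈ (φ c) _ (φ-IsB c′) φ-agree-below (φ-at c x x∈) i p i<x ⟨
    isLmap (φ c′) i  ∎
    where open ≡-Reasoning
  by-position (tri≈ _ refl _) =
    trans (isLmap-at x x∈ (α c) _ (α-IsB c′) (α-agree c x x∈) (α-at c x x∈))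
          (sym (isLmap-at x x∈ (φ c) _ (φ-IsB c′) φ-agree-below (φ-at c x x∈)))
  by-position (tri> _ _ x<i) =
    trans (isLmap-above x x∈ (α c) _ (α-IsB c′) (α-agree c x x∈) (α-at c x x∈) i x<i q)
          (sym (isLmap-above x x∈ (φ c) _ (φ-IsB c′) φ-agree-below (φ-at c x x∈) i x<i q))

filterᵇ-range1-cong : ∀ {m n} {p q : ℕ → Bool} → m ≡ n → (∀ i → Range n i → p i ≡ q i) →
                      filterᵇ p (range1 m) ≡ filterᵇ q (range1 n)
filterᵇ-range1-cong {n = n} refl h = filterᵇ-cong (All.map (h _) (All-range1 n))

Lmap-α-φ : ∀ {n} (c : Code n) → Lmap (α c) ≡ Lmap (φ c)
Lmap-α-φ {n} c = trans (filterᵇ-range1-cong (length-α c) (isLmap-α-φ c))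
  (sym (filterᵇ-range1-cong (length-φ c) (λ _ _ → refl)))

-- Cycles of the absolute value permutation

Cycle : Word → ℕ → List ℕ → Set
Cycle w m ys = Path (absPerm w) (_≡ m) (absPerm w m) ys m

Cycle-fixed : ∀ w {m} → absPerm w m ≡ m → Cycle w m []
Cycle-fixed w {m} e = subst (λ y → Path (absPerm w) (_≡ m) y [] m) (sym e) (stop refl)

-- Exhausted fuel at the return point still yields the correct empty list, so `≤` suffices, whereas
-- `bstep` needs one more unit to produce its value.
orbit-path : ∀ f w {m x ys r} → Path (absPerm w) (_≡ m) x ys r → length ys ≤ f → orbit f w m x ≡ ys
orbit-path zero    w (stop s)   _ = refl
orbit-path (suc f) w (stop s)   _ rewrite ≡ᵇ-true s = refl
orbit-path (suc f) w (step s p) (s≤s l) rewrite ≡ᵇ-false s = cong (_ ∷_) (orbit-path f w p l)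

module _ {n : ℕ} {w : Word} (b : IsB n w) where

  Path-Range : ∀ {Stop x ys r} → Range n x → Path (absPerm w) Stop x ys r → All (Range n) ys
  Path-Range r p = Path-All (IsB-range b) p r

  cycleOf-Cycle : ∀ {m ys} → Range n m → Cycle w m ys → cycleOf w m ≡ m ∷ ys
  cycleOf-Cycle {m} r p = cong (m ∷_) (orbit-path (length w) w p
    (subst (_ ≤_) (sym (proj₁ b)) (Unique-length≤ (Path-unique p) (Path-Range (IsB-range b m r) p))))

insAfter : ℕ → ℕ → List ℕ → List ℕ
insAfter a N []       = []
insAfter a N (y ∷ ys) = if y ℕ.≡ᵇ a then y ∷ N ∷ insAfter a N ys else y ∷ insAfter a N ys

even-𝟙+ : ∀ b k → even (𝟙 b ℕ.+ k) ≡ b xor even k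
even-𝟙+ false k             = refl
even-𝟙+ true  zero          = refl
even-𝟙+ true  (suc zero)    = refl
even-𝟙+ true  (suc (suc k)) = even-𝟙+ true k

even-count-∷ : ∀ {A : Set} (p : A → Bool) x xs → even (count p (x ∷ xs)) ≡ p x xor even (count p xs)
even-count-∷ p x xs = trans (cong even (count-∷ p x xs)) (even-𝟙+ (p x) (count p xs))

-- If |x| ≤ n, the cycle of |σ| through |x| gets n + 1 inserted after |x|; the number of its
-- negative letters keeps its parity.
module _ {n : ℕ} (c : Code n) (x : ℤ) (x∈ : InR (suc n) x) where

  private
    a = ∣ x ∣
    N = suc n
    w = φ c
    w′ = φ (snoc c x x∈)

  absPerm-at : absPerm w′ a ≡ N
  absPerm-at = trans (cong ∣_∣ (φ-at c x x∈)) (∣signed∣ x N)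

  absPerm-last : a ≤ n → absPerm w′ N ≡ absPerm w a
  absPerm-last a≤n = trans (cong ∣_∣ (φ-last c x x∈)) (trans (∣Φ∣ x) (cong ∣_∣ (sym (φ-! c a (proj₁ x∈ , a≤n)))))
    where
    ∣Φ∣ : ∀ x → ∣ Φ c x ∣ ≡ ∣ Φ c (+ ∣ x ∣) ∣
    ∣Φ∣ (+ k)     = refl
    ∣Φ∣ -[1+ k ]  = trans (cong ∣_∣ (Φ-odd c (+ suc k))) (ℤ.∣-i∣≡∣i∣ (Φ c (+ suc k)))

  -- The letter at `∣ x ∣` has the sign of `x`, and the letter at `n + 1` is the old letter at
  -- `∣ x ∣` times that same sign; the two occurrences cancel.
  isNeg-at-last : a ≤ n → isNeg (w′ ! a) xor isNeg (w′ ! N) ≡ isNeg (w ! a)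
  isNeg-at-last a≤n rewrite φ-at c x x∈ | φ-last c x x∈ | φ-! c a (proj₁ x∈ , a≤n) =
    by-sign x (proj₁ (Φ-range c (+ ∣ x ∣) ℕ.≤-refl (proj₁ x∈ , a≤n)))
    where
    isNeg-neg : ∀ z → 1 ≤ ∣ z ∣ → not (isNeg (- z)) ≡ isNeg z
    isNeg-neg (+ suc k) _ = refl
    isNeg-neg -[1+ k ]  _ = refl
    by-sign : ∀ x → 1 ≤ ∣ Φ c (+ ∣ x ∣) ∣ →
              isNeg (signed x N) xor isNeg (Φ c x) ≡ isNeg (Φ c (+ ∣ x ∣))
    by-sign (+ k)     _ = refl
    by-sign -[1+ k ]  h = trans (cong (not ∘ isNeg) (Φ-odd c (+ suc k))) (isNeg-neg (Φ c (+ suc k)) h)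

  absPerm-agree : ∀ y → Range n y → y ≢ a → absPerm w′ y ≡ absPerm w y
  absPerm-agree y r ne = cong ∣_∣ (φ-agree c x x∈ y r ne)

  private
    π-range : ∀ {y} → Range n y → Range n (absPerm w y)
    π-range {y} = IsB-range (φ-IsB c) y

    subst-start : ∀ {m y z ys r} → y ≡ z → Path (absPerm w′) (_≡ m) z ys r → Path (absPerm w′) (_≡ m) y ys r
    subst-start {m} e = subst (λ y → Path (absPerm w′) (_≡ m) y _ _) (sym e)

  Path-insAfter : ∀ {m y ys r} → m ≤ n → Range n y → Path (absPerm w) (_≡ m) y ys r →
                  Path (absPerm w′) (_≡ m) y (insAfter a N ys) r
  Path-insAfter m≤n y∈ (stop s) = stop s
  Path-insAfter {m} {y} m≤n y∈ (step s p) with rec ← Path-insAfter m≤n (π-range y∈) p with y ℕ.≟ a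
  ... | yes refl rewrite ≡ᵇ-true {a} refl =
    step s (subst-start absPerm-at (step (λ e → ℕ.<⇒≱ (ℕ.≤-reflexive e) m≤n) (subst-start (absPerm-last (proj₂ y∈)) rec)))
  ... | no y≢a   rewrite ≡ᵇ-false y≢a = step s (subst-start (absPerm-agree y y∈ y≢a) rec)

  -- The starting point `m` may itself be `∣ x ∣`, in which case the new letter follows `m`; so the
  -- insertion is performed in `m ∷ ys`, not in `ys`.
  Cycle-insAfter : ∀ {m ys} → Range n m → Cycle w m ys →
                   ∃ λ ys′ → Cycle w′ m ys′ × m ∷ ys′ ≡ insAfter a N (m ∷ ys)
  Cycle-insAfter {m} m∈ p with rec ← Path-insAfter (proj₂ m∈) (π-range m∈) p with m ℕ.≟ a
  ... | yes refl rewrite ≡ᵇ-true {a} refl =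
    _ , subst-start absPerm-at (step (λ e → ℕ.<⇒≱ (ℕ.≤-reflexive e) (proj₂ m∈)) (subst-start (absPerm-last (proj₂ m∈)) rec)) , refl
  ... | no m≢a   rewrite ≡ᵇ-false m≢a = _ , subst-start (absPerm-agree m m∈ m≢a) rec , refl

  -- The cycle of `n + 1` is the old cycle of `∣ x ∣` entered at the image of `∣ x ∣`: the old run
  -- ended on reaching `∣ x ∣`, the new one takes one more step from there to `n + 1`.
  Cycle-max : ∀ {y ys} → a ≤ n → Range n y → Path (absPerm w) (_≡ a) y ys a →
              Path (absPerm w′) (_≡ N) y (ys ∷ʳ a) N
  Cycle-max a≤n y∈ (stop refl) = step (ℕ.<⇒≢ (s≤s a≤n)) (subst-start absPerm-at (stop refl))
  Cycle-max {y} a≤n y∈ (step s p) = step (ℕ.<⇒≢ (s≤s (proj₂ y∈)))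
    (subst-start (absPerm-agree y y∈ s) (Cycle-max a≤n (π-range y∈) p))

  all-insAfter : ∀ {m} ys → m ≤ N → all (m ℕ.≤ᵇ_) (insAfter a N ys) ≡ all (m ℕ.≤ᵇ_) ys
  all-insAfter []       l = refl
  all-insAfter {m} (y ∷ ys) l with y ℕ.≡ᵇ a
  ... | true  rewrite ≤ᵇ-true l = cong ((m ℕ.≤ᵇ y) ∧_) (all-insAfter ys l)
  ... | false = cong ((m ℕ.≤ᵇ y) ∧_) (all-insAfter ys l)

  parity-insAfter : ∀ ys → All (Range n) ys →
                    even (count (λ y → isNeg (w′ ! y)) (insAfter a N ys)) ≡ even (count (λ y → isNeg (w ! y)) ys)
  parity-insAfter []       []       = refl
  parity-insAfter (y ∷ ys) (r ∷ rs) with rec ← parity-insAfter ys rs with y ℕ.≟ a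
  ... | yes refl rewrite ≡ᵇ-true {a} refl = begin
      even (count neg′ (a ∷ N ∷ insAfter a N ys))
        ≡⟨ trans (even-count-∷ neg′ a _) (cong (neg′ a xor_) (even-count-∷ neg′ N _)) ⟩
      neg′ a xor (neg′ N xor even (count neg′ (insAfter a N ys)))
        ≡⟨ xor-assoc (neg′ a) (neg′ N) _ ⟨
      (neg′ a xor neg′ N) xor even (count neg′ (insAfter a N ys))
        ≡⟨ cong₂ _xor_ (isNeg-at-last (proj₂ r)) rec ⟩
      isNeg (w ! a) xor even (count (λ y → isNeg (w ! y)) ys)
        ≡⟨ even-count-∷ (λ y → isNeg (w ! y)) a ys ⟨
      even (count (λ y → isNeg (w ! y)) (a ∷ ys)) ∎
    where
    open ≡-Reasoning
    neg′ : ℕ → Bool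
    neg′ z = isNeg (w′ ! z)
  ... | no y≢a rewrite ≡ᵇ-false y≢a = begin
      even (count neg′ (y ∷ insAfter a N ys))
        ≡⟨ even-count-∷ neg′ y _ ⟩
      neg′ y xor even (count neg′ (insAfter a N ys))
        ≡⟨ cong₂ _xor_ (cong isNeg (φ-agree c x x∈ y r y≢a)) rec ⟩
      isNeg (w ! y) xor even (count (λ y → isNeg (w ! y)) ys)
        ≡⟨ even-count-∷ (λ y → isNeg (w ! y)) y ys ⟨
      even (count (λ y → isNeg (w ! y)) (y ∷ ys)) ∎
    where
    open ≡-Reasoning
    neg′ : ℕ → Bool
    neg′ z = isNeg (w′ ! z)

-- That every run returns is shown along the code: an old cycle is lengthened by at most one letter,
-- and `n + 1` is either a fixed point or joins the cycle of `∣ x ∣`.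
cycle : ∀ {n} (c : Code n) m → Range n m → ∃ λ ys → Cycle (φ c) m ys
cycle ε m (p , q) = contradiction (ℕ.≤-trans p q) ℕ.1+n≰n
cycle {suc n} c′@(snoc c x x∈) m (p , q) with ℕ.m≤n⇒m<n∨m≡n q
... | inj₁ (s≤s m≤n) with ys , path ← cycle c m (p , m≤n)
                     with ys′ , path′ , _ ← Cycle-insAfter c x x∈ (p , m≤n) path = ys′ , path′
... | inj₂ refl with ℕ.m≤n⇒m<n∨m≡n (proj₂ x∈)
...   | inj₂ a≡N = [] , Cycle-fixed (φ c′) (subst (λ m → absPerm (φ c′) m ≡ suc n) a≡N (absPerm-at c x x∈))
...   | inj₁ (s≤s a≤n) with ys , path ← cycle c ∣ x ∣ (proj₁ x∈ , a≤n) =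
  _ , subst (λ y → Path (absPerm (φ c′)) (_≡ suc n) y (ys ∷ʳ ∣ x ∣) (suc n)) (sym (absPerm-last c x x∈ a≤n))
        (Cycle-max c x x∈ a≤n (IsB-range (φ-IsB c) ∣ x ∣ (proj₁ x∈ , a≤n)) path)

isCycMin-Cycle : ∀ {n} (c : Code n) {m ys} → Range n m → Cycle (φ c) m ys →
                 isCycMin (φ c) m ≡ all (m ℕ.≤ᵇ_) (m ∷ ys) ∧ even (count (λ y → isNeg (φ c ! y)) (m ∷ ys))
isCycMin-Cycle c {m} r p = cong (λ l → all (m ℕ.≤ᵇ_) l ∧ even (count (λ y → isNeg (φ c ! y)) l))
  (cycleOf-Cycle (φ-IsB c) r p)

module _ {n : ℕ} (c : Code n) (x : ℤ) (x∈ : InR (suc n) x) where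

  private
    c′ = snoc c x x∈

  isCycMin-init : ∀ m → Range n m → isCycMin (φ c′) m ≡ isCycMin (φ c) m
  isCycMin-init m r with ys , p ← cycle c m r with ys′ , p′ , e ← Cycle-insAfter c x x∈ r p = begin
    isCycMin (φ c′) m                ≡⟨ isCycMin-Cycle c′ (Range-suc r) p′ ⟩
    stat′ (m ∷ ys′)                  ≡⟨ cong stat′ e ⟩
    stat′ (insAfter a N (m ∷ ys))    ≡⟨ cong₂ _∧_ (all-insAfter c x x∈ (m ∷ ys) (ℕ.m≤n⇒m≤1+n (proj₂ r)))
                                          (parity-insAfter c x x∈ (m ∷ ys) (r ∷ Path-Range (φ-IsB c) (IsB-range (φ-IsB c) m r) p)) ⟩
    all (m ℕ.≤ᵇ_) (m ∷ ys) ∧ even (count (λ y → isNeg (φ c ! y)) (m ∷ ys))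
                                     ≡⟨ isCycMin-Cycle c r p ⟨
    isCycMin (φ c) m                 ∎
    where
    open ≡-Reasoning
    a = ∣ x ∣
    N = suc n
    stat′ : List ℕ → Bool
    stat′ l = all (m ℕ.≤ᵇ_) l ∧ even (count (λ y → isNeg (φ c′ ! y)) l)

  -- If `∣ x ∣ = n + 1` the cycle is a fixed point, and its parity is even exactly for positive `x`.
  -- Otherwise the cycle contains the smaller number `∣ x ∣`, so `n + 1` is not its minimum.
  isCycMin-last : isCycMin (φ c′) (suc n) ≡ (x ==ᶻ + suc n)
  isCycMin-last with ℕ.m≤n⇒m<n∨m≡n (proj₂ x∈)
  ... | inj₂ a≡N = begin
      isCycMin (φ c′) (suc n)
        ≡⟨ isCycMin-Cycle c′ {ys = []} (s≤s z≤n , ℕ.≤-refl)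
             (Cycle-fixed (φ c′) (subst (λ m → absPerm (φ c′) m ≡ suc n) a≡N (absPerm-at c x x∈))) ⟩
      ((suc n ℕ.≤ᵇ suc n) ∧ true) ∧ even (count (λ y → isNeg (φ c′ ! y)) (suc n ∷ []))
        ≡⟨ cong₂ (λ b k → (b ∧ true) ∧ k) (≤ᵇ-true {suc n} ℕ.≤-refl)
             (trans (even-count-∷ (λ y → isNeg (φ c′ ! y)) (suc n) []) (cong (λ z → isNeg z xor true)
               (subst (λ m → φ c′ ! m ≡ signed x (suc n)) a≡N (φ-at c x x∈)))) ⟩
      isNeg (signed x (suc n)) xor true
        ≡⟨ by-sign x a≡N ⟩
      x ==ᶻ + suc n ∎
    where
    open ≡-Reasoning
    by-sign : ∀ x → ∣ x ∣ ≡ suc n → isNeg (signed x (suc n)) xor true ≡ (x ==ᶻ + suc n)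
    by-sign (+ _)     refl = sym (isYes-true (+ suc n ℤ.≟ + suc n) refl)
    by-sign -[1+ _ ]  refl = refl
  ... | inj₁ (s≤s a≤n) with ys , path ← cycle c ∣ x ∣ (proj₁ x∈ , a≤n) = begin
      isCycMin (φ c′) (suc n)
        ≡⟨ isCycMin-Cycle c′ (s≤s z≤n , ℕ.≤-refl)
             (subst (λ y → Path (absPerm (φ c′)) (_≡ suc n) y (ys ∷ʳ ∣ x ∣) (suc n)) (sym (absPerm-last c x x∈ a≤n))
               (Cycle-max c x x∈ a≤n (IsB-range (φ-IsB c) ∣ x ∣ (proj₁ x∈ , a≤n)) path)) ⟩
      all (suc n ℕ.≤ᵇ_) (suc n ∷ ys ∷ʳ ∣ x ∣) ∧ parity
        ≡⟨ cong (_∧ parity) (¬T⇒≡ (λ t → ℕ.<⇒≱ (s≤s a≤n) (ℕ.≤ᵇ⇒≤ (suc n) ∣ x ∣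
             (All.lookup (All.all⁺ (suc n ℕ.≤ᵇ_) (suc n ∷ ys ∷ʳ ∣ x ∣) t) (there (∈-++⁺ʳ ys (here refl))))))) ⟩
      false
        ≡⟨ isYes-false (x ℤ.≟ + suc n) (λ e → ℕ.<⇒≢ (s≤s a≤n) (cong ∣_∣ e)) ⟨
      x ==ᶻ + suc n ∎
    where
    open ≡-Reasoning
    parity = even (count (λ y → isNeg (φ c′ ! y)) (suc n ∷ ys ∷ʳ ∣ x ∣))

isRmil-isCycMin : ∀ {n} (c : Code n) v → Range n v → isRmil (α c) v ≡ isCycMin (φ c) v
isRmil-isCycMin ε v (p , q) = contradiction (ℕ.≤-trans p q) ℕ.1+n≰n
isRmil-isCycMin {suc n} (snoc c x x∈) v (p , q) with ℕ.m≤n⇒m<n∨m≡n q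
... | inj₁ (s≤s v≤n) = trans (isRmil-α-init c x x∈ v v≤n)
        (trans (isRmil-isCycMin c v (p , v≤n)) (sym (isCycMin-init c x x∈ v (p , v≤n))))
... | inj₂ refl = trans (isRmil-α-last c x x∈) (sym (isCycMin-last c x x∈))

Rmil-α-CycB-φ : ∀ {n} (c : Code n) → Rmil (α c) ≡ CycB (φ c)
Rmil-α-CycB-φ c = trans (filterᵇ-range1-cong (length-α c) (isRmil-isCycMin c))
  (sym (filterᵇ-range1-cong (length-φ c) (λ _ _ → refl)))

-- Factorizations into reflections

module _ {a b : ℤ} (nza : 1 ≤ ∣ a ∣) (nzb : 1 ≤ ∣ b ∣) where

  swap-comm : ∀ z → swap a b z ≡ swap b a z
  swap-comm z with swapView a b z
  ... | is-a refl  = trans (swap-fst a b) (sym (swap-snd b a))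
  ... | is-b refl  = trans (swap-snd a b) (sym (swap-fst b a))
  ... | is--a refl = trans (swap-neg-fst a b nza) (sym (swap-neg-snd b a nza))
  ... | is--b refl = trans (swap-neg-snd a b nzb) (sym (swap-neg-fst b a nzb))
  ... | other p q  = trans (swap-other a b z p q) (sym (swap-other b a z q p))

  swap-neg-neg : ∀ z → swap (- a) (- b) z ≡ swap a b z
  swap-neg-neg z with swapView a b z
  ... | is-a refl  = trans (trans (cong (swap (- a) (- b)) (sym (ℤ.neg-involutive a)))
                       (trans (swap-neg-fst (- a) (- b) (subst (1 ≤_) (sym (ℤ.∣-i∣≡∣i∣ a)) nza)) (ℤ.neg-involutive b))) (sym (swap-fst a b))
  ... | is-b refl  = trans (trans (cong (swap (- a) (- b)) (sym (ℤ.neg-involutive b)))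
                       (trans (swap-neg-snd (- a) (- b) (subst (1 ≤_) (sym (ℤ.∣-i∣≡∣i∣ b)) nzb)) (ℤ.neg-involutive a))) (sym (swap-snd a b))
  ... | is--a refl = trans (swap-fst (- a) (- b)) (sym (swap-neg-fst a b nza))
  ... | is--b refl = trans (swap-snd (- a) (- b)) (sym (swap-neg-snd a b nzb))
  ... | other p q  = trans (swap-other (- a) (- b) z (λ e → p (trans e (ℤ.∣-i∣≡∣i∣ a))) (λ e → q (trans e (ℤ.∣-i∣≡∣i∣ b))))
                       (sym (swap-other a b z p q))

  swap-swap : ∀ c d z → swap a b (swap c d z) ≡ swap (swap a b c) (swap a b d) (swap a b z)
  swap-swap = swap-conj (swap a b) (swap-odd a b nza nzb) (swap-injective a b nza nzb)

  -- The conjugation relation read the other way: the inner reflection moves to the outside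
  -- unchanged, while the outer one has its endpoints transformed.
  swap-swap′ : ∀ c d z → swap c d (swap a b z) ≡ swap a b (swap (swap a b c) (swap a b d) z)
  swap-swap′ c d z = sym (trans (swap-swap (swap a b c) (swap a b d) z)
    (cong₂ (λ c d → swap c d (swap a b z)) (swap-involutive a b nza nzb c) (swap-involutive a b nza nzb d)))

swap-self : ∀ a z → 1 ≤ ∣ a ∣ → swap a a z ≡ z
swap-self a z nz with swapView a a z
... | is-a refl  = swap-fst a a
... | is-b refl  = swap-snd a a
... | is--a refl = swap-neg-fst a a nz
... | is--b refl = swap-neg-snd a a nz
... | other p q  = swap-other a a z p q

lo : Refl → ℤ
lo (tr i j)  = + i
lo (ntr i j) = - + i
lo (fl j)    = - + j

-- All three kinds of reflection become one swap of a signed endpoint `lo t` with the positive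
-- endpoint `jOf t`; the sign change `fl j` is the swap of `- j` and `j`.
record Ends (n : ℕ) (t : Refl) : Set where
  field
    hi≥1   : 1 ≤ jOf t
    hi≤    : jOf t ≤ n
    lo∈    : InR (jOf t) (lo t)
    lo≢hi  : lo t ≢ + jOf t
    apply  : ∀ z → applyRefl t z ≡ swap (lo t) (+ jOf t) z
    cost≡  : weight t ≡ cost (jOf t) (lo t)

ends : ∀ {n t} → ValidRefl n t → Ends n t
ends {t = tr i j} (p , q , r) = record
  { hi≥1 = ℕ.≤-trans p (ℕ.<⇒≤ q) ; hi≤ = r ; lo∈ = p , ℕ.<⇒≤ q
  ; lo≢hi = λ e → ℕ.<⇒≢ q (ℤ.+-injective e) ; apply = λ z → refl ; cost≡ = refl }
ends {t = ntr (suc i) j} (p , q , r) = record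
  { hi≥1 = ℕ.≤-trans p (ℕ.<⇒≤ q) ; hi≤ = r ; lo∈ = p , ℕ.<⇒≤ q
  ; lo≢hi = λ () ; apply = λ z → refl ; cost≡ = refl }
ends {t = fl (suc j)} (p , q) = record
  { hi≥1 = p ; hi≤ = q ; lo∈ = p , ℕ.≤-refl ; lo≢hi = λ () ; apply = apply ; cost≡ = refl }
  where
  apply : ∀ z → applyRefl (fl (suc j)) z ≡ swap -[1+ j ] (+ suc j) z
  apply z with z ℤ.≟ + suc j | z ℤ.≟ -[1+ j ]
  ... | yes refl | yes ()
  ... | yes _    | no _  = refl
  ... | no _     | yes _ = refl
  ... | no _     | no _  = refl

refl-with-ends : ∀ {n} x N → InR N x → N ≤ n → x ≢ + N → ∃ λ t → ValidRefl n t × lo t ≡ x × jOf t ≡ N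
refl-with-ends (+ k) N (p , q) l ne = tr k N , (p , ℕ.≤∧≢⇒< q (ne ∘ cong +_) , l) , refl , refl
refl-with-ends -[1+ k ] N (p , q) l ne with suc k ℕ.≟ N
... | yes refl = fl N , (p , l) , refl , refl
... | no ne′   = ntr (suc k) N , (p , ℕ.≤∧≢⇒< q ne′ , l) , refl , refl

ordered-swap-refl : ∀ {n} a b → InR ∣ b ∣ a → InR n b → a ≢ b →
                    ∃ λ t → ValidRefl n t × (∀ z → applyRefl t z ≡ swap a b z)
ordered-swap-refl a (+ j) a∈ (p , q) ne
  with t , v , refl , refl ← refl-with-ends a j a∈ q ne = t , v , Ends.apply (ends v)
-- Negating both endpoints does not change the swap and makes the larger one positive, as `Refl`
-- requires.
ordered-swap-refl a -[1+ j ] a∈ (p , q) ne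
  with t , v , lo≡ , hi≡ ← refl-with-ends (- a) (suc j) (subst (Range (suc j)) (sym (ℤ.∣-i∣≡∣i∣ a)) a∈) q (ne ∘ -≡⇒≡-) =
  t , v , λ z → trans (Ends.apply (ends v) z)
    (trans (cong₂ (λ y j → swap y (+ j) z) lo≡ hi≡) (swap-neg-neg {a} { -[1+ j ]} (proj₁ a∈) p z))

swap-refl : ∀ {n} a b → InR n a → InR n b → a ≢ b → ∃ λ t → ValidRefl n t × (∀ z → applyRefl t z ≡ swap a b z)
swap-refl a b a∈ b∈ ne with ℕ.≤-total ∣ a ∣ ∣ b ∣
... | inj₁ l = ordered-swap-refl a b (proj₁ a∈ , l) b∈ ne
... | inj₂ l with t , v , e ← ordered-swap-refl b a (proj₁ b∈ , l) a∈ (ne ∘ sym) =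
  t , v , λ z → trans (e z) (swap-comm {b} {a} (proj₁ b∈) (proj₁ a∈) z)

valid-mono : ∀ {m n} t → m ≤ n → ValidRefl m t → ValidRefl n t
valid-mono (tr i j)  l (p , q , r) = p , q , ℕ.≤-trans r l
valid-mono (ntr i j) l (p , q , r) = p , q , ℕ.≤-trans r l
valid-mono (fl j)    l (p , q)     = p , ℕ.≤-trans q l

valid-restrict : ∀ {m n} t → jOf t ≤ m → ValidRefl n t → ValidRefl m t
valid-restrict (tr i j)  l (p , q , _) = p , q , l
valid-restrict (ntr i j) l (p , q , _) = p , q , l
valid-restrict (fl j)    l (p , _)     = p , l

prodApply-++ : ∀ ts us z → prodApply (ts ++ us) z ≡ prodApply ts (prodApply us z)
prodApply-++ []       us z = refl
prodApply-++ (t ∷ ts) us z = cong (applyRefl t) (prodApply-++ ts us z)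

record Factorization {n} (c : Code n) : Set where
  field
    factors     : List Refl
    valid       : All (ValidRefl n) factors
    product     : ∀ z → prodApply factors z ≡ Φ c z
    increasing  : AllPairs _<_ (map jOf factors)
    length≡     : length factors ≡ ℓ c
    weight≡     : sum (map weight factors) ≡ wt c

-- A letter `x = n + 1` stands for the identity and yields no factor; it counts 0 in both `wt` and
-- `ℓ`.
factorization : ∀ {n} (c : Code n) → Factorization c
factorization ε = record
  { factors = [] ; valid = [] ; product = λ _ → refl ; increasing = [] ; length≡ = refl ; weight≡ = refl }
factorization {suc n} (snoc c x x∈) with x ℤ.≟ + suc n
... | yes refl = record
  { factors    = factors
  ; valid      = All.map (valid-mono _ (ℕ.n≤1+n n)) valid
  ; product    = λ z → trans (product z) (cong (Φ c) (sym (swap-self (+ suc n) z (s≤s z≤n))))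
  ; increasing = increasing
  ; length≡    = trans length≡ (sym (trans
      (cong (λ b → ℓ c ℕ.+ 𝟙 (not b)) (isYes-true (+ suc n ℤ.≟ + suc n) refl)) (ℕ.+-identityʳ (ℓ c))))
  ; weight≡    = trans weight≡ (trans (sym (ℕ.+-identityʳ (wt c))) (cong (wt c ℕ.+_) (sym (ℕ.n∸n≡0 n))))
  }
  where open Factorization (factorization c)
... | no x≢N with t , v , refl , hi ← refl-with-ends {suc n} x (suc n) x∈ ℕ.≤-refl x≢N = record
  { factors    = factors ∷ʳ t
  ; valid      = All.++⁺ (All.map (valid-mono _ (ℕ.n≤1+n n)) valid) (v ∷ [])
  ; product    = λ z → trans (prodApply-++ factors (t ∷ []) z) (trans (product (applyRefl t z))
                   (cong (Φ c) (trans (Ends.apply (ends v) z) (cong (λ N → swap (lo t) (+ N) z) hi))))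
  ; increasing = subst (AllPairs _<_) (sym (map-++ jOf factors (t ∷ [])))
                   (AllPairs.++⁺ increasing ([] ∷ []) (All.map⁺ (All.map (λ u → subst (_ <_) (sym hi) (s≤s (Ends.hi≤ (ends u))) ∷ []) valid)))
  ; length≡    = trans (length-++ factors) (cong₂ ℕ._+_ length≡
      (cong (𝟙 ∘ not) (sym (isYes-false (lo t ℤ.≟ + suc n) x≢N))))
  ; weight≡    = begin
      sum (map weight (factors ∷ʳ t))                  ≡⟨ cong sum (map-++ weight factors (t ∷ [])) ⟩
      sum (map weight factors ++ weight t ∷ [])        ≡⟨ sum-++ (map weight factors) (weight t ∷ []) ⟩
      sum (map weight factors) ℕ.+ (weight t ℕ.+ 0)    ≡⟨ cong₂ ℕ._+_ weight≡ (trans (ℕ.+-identityʳ (weight t))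
                                                           (trans (Ends.cost≡ (ends v)) (cong (λ N → cost N (lo t)) hi))) ⟩
      wt c ℕ.+ cost (suc n) (lo t)                     ∎
  }
  where
  open Factorization (factorization c)
  open ≡-Reasoning

-- Increasing factorizations and the sorting index

record IncreasingSplit (n : ℕ) (ts : List Refl) : Set where
  field
    init        : List Refl
    x           : ℤ
    x∈          : InR (suc n) x
    valid       : All (ValidRefl n) init
    increasing  : AllPairs _<_ (map jOf init)
    -- Carried through the recursion so that the head, whose index is below all later ones, can be
    -- put back in front of `init`.
    inherit     : ∀ {m} → All (m <_) (map jOf ts) → All (m <_) (map jOf init)
    product     : ∀ z → prodApply ts z ≡ prodApply init (swap x (+ suc n) z)
    weight≡     : sum (map weight ts) ≡ sum (map weight init) ℕ.+ cost (suc n) x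

increasingSplit : ∀ {n} ts → All (ValidRefl (suc n)) ts → AllPairs _<_ (map jOf ts) → IncreasingSplit n ts
increasingSplit {n} [] _ _ = record
  { init = [] ; x = + suc n ; x∈ = s≤s z≤n , ℕ.≤-refl ; valid = [] ; increasing = [] ; inherit = λ _ → []
  ; product = λ z → sym (swap-self (+ suc n) z (s≤s z≤n)) ; weight≡ = sym (ℕ.n∸n≡0 n) }
increasingSplit {n} (t ∷ ts) (v ∷ vs) (t< ∷ inc) with jOf t ℕ.≤? n
... | yes l = record
  { init = t ∷ init ; x = x ; x∈ = x∈ ; valid = valid-restrict t l v ∷ valid ; increasing = inherit t< ∷ increasing
  ; inherit = λ { (p ∷ ps) → p ∷ inherit ps }
  ; product = λ z → cong (applyRefl t) (product z)
  ; weight≡ = trans (cong (weight t ℕ.+_) weight≡) (sym (ℕ.+-assoc (weight t) _ _)) }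
  where open IncreasingSplit (increasingSplit ts vs inc)
... | no ¬l with ts | vs | t<
-- Indices increase, so a factor moving `n + 1` must be the last one.
...   | u ∷ _ | vu ∷ _ | t<u ∷ _ = contradiction (ℕ.≤-pred (ℕ.≤-trans t<u (Ends.hi≤ (ends vu)))) ¬l
...   | [] | _ | _ = record
  { init = [] ; x = lo t ; x∈ = subst (λ N → InR N (lo t)) hi (Ends.lo∈ (ends v))
  ; valid = [] ; increasing = [] ; inherit = λ _ → []
  ; product = λ z → trans (Ends.apply (ends v) z) (cong (λ N → swap (lo t) (+ N) z) hi)
  ; weight≡ = trans (ℕ.+-identityʳ (weight t)) (trans (Ends.cost≡ (ends v)) (cong (λ N → cost N (lo t)) hi)) }
  where
  hi : jOf t ≡ suc n
  hi = ℕ.≤-antisym (Ends.hi≤ (ends v)) (ℕ.≰⇒> ¬l)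

valid-zero : ∀ {ts} → All (ValidRefl 0) ts → ts ≡ []
valid-zero []      = refl
valid-zero (v ∷ _) = contradiction (ℕ.≤-trans (Ends.hi≥1 (ends v)) (Ends.hi≤ (ends v))) ℕ.1+n≰n

increasing⇒code : ∀ n ts → All (ValidRefl n) ts → AllPairs _<_ (map jOf ts) →
                  ∃ λ (c : Code n) → (∀ z → prodApply ts z ≡ Φ c z) × sum (map weight ts) ≡ wt c
increasing⇒code zero ts vs _ with refl ← valid-zero vs = ε , (λ _ → refl) , refl
increasing⇒code (suc n) ts vs inc = extend (increasing⇒code n init valid increasing)
  where
  open IncreasingSplit (increasingSplit ts vs inc)
  extend : (∃ λ (c : Code n) → (∀ z → prodApply init z ≡ Φ c z) × sum (map weight init) ≡ wt c) →
           ∃ λ (c : Code (suc n)) → (∀ z → prodApply ts z ≡ Φ c z) × sum (map weight ts) ≡ wt c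
  extend (c , e , s) =
    snoc c x x∈ , (λ z → trans (product z) (e _)) , trans weight≡ (cong (ℕ._+ cost (suc n) x) s)

-- The B-code reads the code off the window alone, so two products that agree on `1, …, n` come from
-- the same code.
product-code-unique : ∀ {n} (c d : Code n) {ts} → (∀ z → prodApply ts z ≡ Φ d z) →
                      (∀ i → 1 ≤ i → i ≤ n → prodApply ts (+ i) ≡ φ c ! i) → d ≡ c
product-code-unique c d e h = toList-injective d c (begin
    toList d    ≡⟨ Bcode-φ d ⟨
    Bcode (φ d) ≡⟨ cong Bcode (word-ext (φ d) (φ c) (length-φ d) (length-φ c)
                     λ i r → trans (φ-! d i r) (trans (sym (e (+ i))) (h i (proj₁ r) (proj₂ r)))) ⟩
    Bcode (φ c) ≡⟨ Bcode-φ c ⟩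
    toList c    ∎)
  where open ≡-Reasoning

φ-IsSorB : ∀ {n} (c : Code n) → IsSorB n (φ c) (wt c)
φ-IsSorB {n} c =
  (factors , ((valid , λ i p q → trans (product (+ i)) (sym (φ-! c i (p , q)))) , AllPairs⇒Linked increasing) , weight≡)
  , unique
  where
  open Factorization (factorization c)
  unique : ∀ ts → IsIncFact n ts (φ c) → sum (map weight ts) ≡ wt c
  unique ts ((vs , h) , inc) with d , e , s ← increasing⇒code n ts vs (Linked⇒AllPairs ℕ.<-trans inc)
    with refl ← product-code-unique c d {ts} e h = s

-- Normal form of a product of two reflections moving ±N: at most one factor still moves ±N.
merge : ∀ n a b → InR (suc n) a → InR (suc n) b → a ≢ + suc n → b ≢ + suc n → a ≢ b →
        ∃ λ t → ∃ λ x → InR (suc n) x × ValidRefl n t ×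
        (∀ z → swap a (+ suc n) (swap b (+ suc n) z) ≡ applyRefl t (swap x (+ suc n) z))
-- Conjugating by `(a,N)` gives `(b′,a)(a,N)`, where `b′` is the image of `b`: it is `b` in the
-- fourth case and `-a` in the third. For `a = -N` or `b = -a` the left factor would still move `N`,
-- so these two cases need other relations.
merge n a b a∈ b∈ a≢N b≢N a≢b with a ℤ.≟ - (+ suc n) | ∣ a ∣ ℕ.≟ ∣ b ∣ | b ℤ.≟ - (+ suc n)
... | yes refl | _ | _ = first
  where
  N -N -b : ℤ
  N = + suc n
  -N = - N
  -b = - b
  N≥1 : 1 ≤ ∣ N ∣
  N≥1 = s≤s z≤n
  b≥1 = proj₁ b∈
  b<N : ∣ b ∣ ≢ suc n
  b<N e = [ b≢N , a≢b ∘ sym ]′ (∣∣-cases b N e)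
  -b∈ : InR (suc n) -b
  -b∈ = subst (Range (suc n)) (sym (ℤ.∣-i∣≡∣i∣ b)) b∈
  -b<N : ∣ -b ∣ ≢ suc n
  -b<N e = b<N (trans (sym (ℤ.∣-i∣≡∣i∣ b)) e)
  first : ∃ λ t → ∃ λ x → InR (suc n) x × ValidRefl n t ×
          (∀ z → swap -N N (swap b N z) ≡ applyRefl t (swap x N z))
  -- Two conjugations: `(-N,N)(b,N) = (b,N)(-b,b) = (-b,b)(-b,N)`.
  first with t , v , e ← swap-refl -b b (∣∣-≤suc {z = -b} -b∈ -b<N) (∣∣-≤suc {z = b} b∈ b<N) (x≢-x {b} b≥1 ∘ sym) =
    t , -b , -b∈ , v , λ z → begin
      swap -N N (swap b N z)                            ≡⟨ swap-swap′ {b} {N} b≥1 N≥1 -N N z ⟩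
      swap b N (swap (swap b N -N) (swap b N N) z)      ≡⟨ cong₂ (λ c d → swap b N (swap c d z)) (swap-neg-snd b N N≥1) (swap-snd b N) ⟩
      swap b N (swap -b b z)                            ≡⟨ swap-swap′ { -b} {b} (proj₁ -b∈) b≥1 b N z ⟩
      swap -b b (swap (swap -b b b) (swap -b b N) z)    ≡⟨ cong₂ (λ c d → swap -b b (swap c d z)) (swap-snd -b b) (swap-other -b b N (-b<N ∘ sym) (b<N ∘ sym)) ⟩
      swap -b b (swap -b N z)                           ≡⟨ e (swap -b N z) ⟨
      applyRefl t (swap -b N z)                         ∎
    where open ≡-Reasoning
... | no a≢-N | yes a≈b | _ = second
  where
  N -N -a : ℤ
  N = + suc n
  -N = - N
  -a = - a
  N≥1 : 1 ≤ ∣ N ∣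
  N≥1 = s≤s z≤n
  a≥1 = proj₁ a∈
  a<N : ∣ a ∣ ≢ suc n
  a<N e = [ a≢N , a≢-N ]′ (∣∣-cases a N e)
  -a<N : ∣ -a ∣ ≢ suc n
  -a<N e = a<N (trans (sym (ℤ.∣-i∣≡∣i∣ a)) e)
  -a∈ : InR (suc n) -a
  -a∈ = subst (Range (suc n)) (sym (ℤ.∣-i∣≡∣i∣ a)) a∈
  b≡-a : b ≡ -a
  b≡-a = [ (λ e → contradiction (sym e) a≢b) , id ]′ (∣∣-cases b a (sym a≈b))
  F : ℤ → ℤ
  F = swap -a a
  F-N : ∀ {z} → ∣ z ∣ ≡ suc n → F z ≡ z
  F-N {z} e = swap-other -a a z (λ e′ → -a<N (trans (sym e′) e)) (λ e′ → a<N (trans (sym e′) e))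
  FF : ∀ z → F (F z) ≡ z
  FF = swap-involutive -a a (proj₁ -a∈) a≥1
  second : ∃ λ t → ∃ λ x → InR (suc n) x × ValidRefl n t ×
           (∀ z → swap a N (swap b N z) ≡ applyRefl t (swap x N z))
  -- The product negates both `a` and `N`. Writing `(-a,N)` as `F (a,N) F`, the conjugate
  -- `(a,N) F (a,N)` is `(-N,N)`, which commutes with `F`.
  second with t , v , e ← swap-refl -a a (∣∣-≤suc {z = -a} -a∈ -a<N) (∣∣-≤suc {z = a} a∈ a<N) (x≢-x {a} a≥1 ∘ sym) =
    t , -N , (s≤s z≤n , ℕ.≤-refl) , v , λ z → begin
      swap a N (swap b N z)                    ≡⟨ cong (λ b → swap a N (swap b N z)) b≡-a ⟩
      swap a N (swap -a N z)                   ≡⟨ cong (λ y → swap a N (swap -a N y)) (FF z) ⟨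
      swap a N (swap -a N (F (F z)))           ≡⟨ cong (swap a N) (swap-swap′ { -a} {a} (proj₁ -a∈) a≥1 -a N (F z)) ⟩
      swap a N (F (swap (F -a) (F N) (F z)))   ≡⟨ cong₂ (λ c d → swap a N (F (swap c d (F z)))) (swap-fst -a a) (F-N refl) ⟩
      swap a N (F (swap a N (F z)))            ≡⟨ swap-swap {a} {N} a≥1 N≥1 -a a (swap a N (F z)) ⟩
      swap (swap a N -a) (swap a N a) (swap a N (swap a N (F z)))
        ≡⟨ cong₂ (λ c d → swap c d (swap a N (swap a N (F z)))) (swap-neg-fst a N a≥1) (swap-fst a N) ⟩
      swap -N N (swap a N (swap a N (F z)))    ≡⟨ cong (swap -N N) (swap-involutive a N a≥1 N≥1 (F z)) ⟩
      swap -N N (F z)                          ≡⟨ swap-swap′ { -a} {a} (proj₁ -a∈) a≥1 -N N z ⟩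
      F (swap (F -N) (F N) z)                  ≡⟨ cong₂ (λ c d → F (swap c d z)) (F-N refl) (F-N refl) ⟩
      F (swap -N N z)                          ≡⟨ e (swap -N N z) ⟨
      applyRefl t (swap -N N z)                ∎
    where open ≡-Reasoning
... | no a≢-N | no a≉b | yes refl = third
  where
  N -N -a : ℤ
  N = + suc n
  -N = - N
  -a = - a
  N≥1 : 1 ≤ ∣ N ∣
  N≥1 = s≤s z≤n
  a≥1 = proj₁ a∈
  -a<N : ∣ -a ∣ ≢ suc n
  -a<N e = a≉b (trans (sym (ℤ.∣-i∣≡∣i∣ a)) e)
  -a∈ : InR (suc n) -a
  -a∈ = subst (Range (suc n)) (sym (ℤ.∣-i∣≡∣i∣ a)) a∈
  third : ∃ λ t → ∃ λ x → InR (suc n) x × ValidRefl n t ×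
          (∀ z → swap a N (swap -N N z) ≡ applyRefl t (swap x N z))
  third with t , v , e ← swap-refl -a a (∣∣-≤suc {z = -a} -a∈ -a<N) (∣∣-≤suc {z = a} a∈ a≉b) (x≢-x {a} a≥1 ∘ sym) =
    t , a , a∈ , v , λ z → begin
      swap a N (swap -N N z)                              ≡⟨ swap-swap {a} {N} a≥1 N≥1 -N N z ⟩
      swap (swap a N -N) (swap a N N) (swap a N z)        ≡⟨ cong₂ (λ c d → swap c d (swap a N z)) (swap-neg-snd a N N≥1) (swap-snd a N) ⟩
      swap -a a (swap a N z)                              ≡⟨ e (swap a N z) ⟨
      applyRefl t (swap a N z)                            ∎
    where open ≡-Reasoning
... | no a≢-N | no a≉b | no b≢-N = fourth
  where
  N : ℤ
  N = + suc n
  N≥1 : 1 ≤ ∣ N ∣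
  N≥1 = s≤s z≤n
  a≥1 = proj₁ a∈
  a<N : ∣ a ∣ ≢ suc n
  a<N e = [ a≢N , a≢-N ]′ (∣∣-cases a N e)
  b<N : ∣ b ∣ ≢ suc n
  b<N e = [ b≢N , b≢-N ]′ (∣∣-cases b N e)
  fourth : ∃ λ t → ∃ λ x → InR (suc n) x × ValidRefl n t ×
           (∀ z → swap a N (swap b N z) ≡ applyRefl t (swap x N z))
  fourth with t , v , e ← swap-refl b a (∣∣-≤suc {z = b} b∈ b<N) (∣∣-≤suc {z = a} a∈ a<N) (a≢b ∘ sym) =
    t , a , a∈ , v , λ z → begin
      swap a N (swap b N z)                              ≡⟨ swap-swap {a} {N} a≥1 N≥1 b N z ⟩
      swap (swap a N b) (swap a N N) (swap a N z)        ≡⟨ cong₂ (λ c d → swap c d (swap a N z)) (swap-other a N b (a≉b ∘ sym) b<N) (swap-snd a N) ⟩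
      swap b a (swap a N z)                              ≡⟨ e (swap a N z) ⟨
      applyRefl t (swap a N z)                           ∎
    where open ≡-Reasoning

-- Arbitrary factorizations and the reflection length

record ShortSplit (n : ℕ) (ts : List Refl) : Set where
  field
    init     : List Refl
    x        : ℤ
    x∈       : InR (suc n) x
    valid    : All (ValidRefl n) init
    product  : ∀ z → prodApply ts z ≡ prodApply init (swap x (+ suc n) z)
    length≤  : length init ℕ.+ 𝟙 (not (x ==ᶻ + suc n)) ≤ length ts

𝟙≤1 : ∀ b → 𝟙 b ≤ 1
𝟙≤1 true  = ℕ.≤-refl
𝟙≤1 false = z≤n

length-∷ʳ : ∀ {A : Set} (xs : List A) y → length (xs ∷ʳ y) ≡ suc (length xs)
length-∷ʳ xs y = trans (length-++ xs) (ℕ.+-comm (length xs) 1)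

module _ {n : ℕ} (ts : List Refl) (split : ShortSplit n ts) (t : Refl) (v : ValidRefl (suc n) t) where
  open ShortSplit split

  private
    N b : ℤ
    N = + suc n
    b = lo t
    open Ends (ends v)

    product-∷ʳ : ∀ z → prodApply (ts ∷ʳ t) z ≡ prodApply init (swap x N (swap b (+ jOf t) z))
    product-∷ʳ z = trans (prodApply-++ ts (t ∷ []) z) (trans (product (applyRefl t z))
      (cong (λ y → prodApply init (swap x N y)) (apply z)))

    lift≤ : ∀ {k} → k ≤ suc (length ts) → k ≤ length (ts ∷ʳ t)
    lift≤ = subst (_ ≤_) (sym (length-∷ʳ ts t))

    nontrivial : x ≢ N → length init ℕ.+ 1 ≤ length ts
    nontrivial x≢N = subst (λ b → length init ℕ.+ 𝟙 (not b) ≤ length ts) (isYes-false (x ℤ.≟ N) x≢N) length≤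

  -- Since `t` fixes `N`, it moves left past `(x,N)` and turns it into `(t x,N)`. As `t x = N` only
  -- for `x = N`, the length count goes up by exactly the new factor.
  shortSplit-∷ʳ-small : jOf t ≤ n → ShortSplit n (ts ∷ʳ t)
  shortSplit-∷ʳ-small l = record
    { init    = init ∷ʳ t
    ; x       = s x
    ; x∈      = swap-preserves b hi b≥1 hi≥1 (Range (suc n)) (b≥1 , b≤) (hi≥1 , hi≤) x x∈
    ; valid   = All.++⁺ valid (valid-restrict t l v ∷ [])
    ; product = λ z → begin
        prodApply (ts ∷ʳ t) z                        ≡⟨ product-∷ʳ z ⟩
        prodApply init (swap x N (s z))              ≡⟨ cong (prodApply init) (swap-swap′ {b} {hi} b≥1 hi≥1 x N z) ⟩
        prodApply init (s (swap (s x) (s N) z))      ≡⟨ cong (λ y → prodApply init (s (swap (s x) y z))) s-N ⟩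
        prodApply init (s (swap (s x) N z))          ≡⟨ cong (prodApply init) (apply _) ⟨
        prodApply init (applyRefl t (swap (s x) N z)) ≡⟨ prodApply-++ init (t ∷ []) _ ⟨
        prodApply (init ∷ʳ t) (swap (s x) N z)       ∎
    ; length≤ = lift≤ (subst (_≤ suc (length ts)) (sym (cong₂ ℕ._+_ (length-∷ʳ init t) (cong (𝟙 ∘ not) fixed))) (s≤s length≤))
    }
    where
    open ≡-Reasoning
    hi : ℤ
    hi = + jOf t
    b≥1 = proj₁ lo∈
    b≤ : ∣ b ∣ ≤ suc n
    b≤ = ℕ.≤-trans (proj₂ lo∈) hi≤
    s : ℤ → ℤ
    s = swap b hi
    s-N : s N ≡ N
    s-N = swap-other b hi N (λ e → ℕ.<⇒≢ (s≤s (ℕ.≤-trans (proj₂ lo∈) l)) (sym e)) (λ e → ℕ.<⇒≢ (s≤s l) (sym e))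
    fixed : (s x ==ᶻ N) ≡ (x ==ᶻ N)
    fixed = isYes-cong (s x ℤ.≟ N) (x ℤ.≟ N) (λ e → swap-injective b hi b≥1 hi≥1 x N (trans e (sym s-N)))
      (λ e → trans (cong s e) s-N)

  -- If `x = N`, the new factor takes the vacant last place; if `x = b`, the two factors cancel.
  -- Otherwise `merge` trades two factors moving `N` for one fixing it and at most one moving it, so
  -- the count never rises by more than 1.
  shortSplit-∷ʳ-large : jOf t ≡ suc n → ShortSplit n (ts ∷ʳ t)
  shortSplit-∷ʳ-large hi with x ℤ.≟ N | x ℤ.≟ b
  ... | yes x≡N | _ = record
    { init    = init
    ; x       = b
    ; x∈      = b∈
    ; valid   = valid
    ; product = λ z → trans (product-∷ʳ z) (cong (prodApply init) (trans
        (cong₂ (λ y j → swap y N (swap b (+ j) z)) x≡N hi) (swap-self N (swap b N z) (s≤s z≤n))))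
    ; length≤ = lift≤ (ℕ.≤-trans (ℕ.+-monoʳ-≤ (length init) (𝟙≤1 (not (b ==ᶻ N))))
                  (subst (_≤ suc (length ts)) (ℕ.+-comm 1 (length init)) (s≤s (ℕ.≤-trans (ℕ.m≤m+n _ _) length≤))))
    }
    where
    b∈ : InR (suc n) b
    b∈ = subst (λ j → InR j b) hi lo∈
  ... | no x≢N | yes x≡b = record
    { init    = init
    ; x       = N
    ; x∈      = s≤s z≤n , ℕ.≤-refl
    ; valid   = valid
    ; product = λ z → trans (product-∷ʳ z) (cong (prodApply init) (trans
        (cong₂ (λ y j → swap y N (swap b (+ j) z)) x≡b hi) (trans (swap-involutive b N (proj₁ lo∈) (s≤s z≤n) z)
          (sym (swap-self N z (s≤s z≤n))))))
    ; length≤ = lift≤ (ℕ.≤-trans (ℕ.+-monoʳ-≤ (length init) (𝟙≤1 (not (N ==ᶻ N)))) (ℕ.m≤n⇒m≤1+n (nontrivial x≢N)))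
    }
  ... | no x≢N | no x≢b
    with u , y , y∈ , vu , e ← merge n x b x∈ (subst (λ j → InR j b) hi lo∈) x≢N
                                  (λ e → lo≢hi (trans e (cong +_ (sym hi)))) x≢b = record
    { init    = init ∷ʳ u
    ; x       = y
    ; x∈      = y∈
    ; valid   = All.++⁺ valid (vu ∷ [])
    ; product = λ z → trans (product-∷ʳ z) (trans (cong (prodApply init)
        (trans (cong (λ j → swap x N (swap b (+ j) z)) hi) (e z))) (sym (prodApply-++ init (u ∷ []) (swap y N z))))
    ; length≤ = lift≤ (ℕ.≤-trans (ℕ.+-monoʳ-≤ (length (init ∷ʳ u)) (𝟙≤1 (not (y ==ᶻ N))))
                  (subst (_≤ suc (length ts)) (sym (cong (ℕ._+ 1) (length-∷ʳ init u))) (s≤s (nontrivial x≢N))))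
    }

shortSplit : ∀ {n} ts → Reverse ts → All (ValidRefl (suc n)) ts → ShortSplit n ts
shortSplit {n} .[] [] _ = record
  { init = [] ; x = + suc n ; x∈ = s≤s z≤n , ℕ.≤-refl ; valid = []
  ; product = λ z → sym (swap-self (+ suc n) z (s≤s z≤n))
  ; length≤ = ℕ.≤-reflexive (cong (𝟙 ∘ not) (isYes-true (+ suc n ℤ.≟ + suc n) refl)) }
shortSplit {n} .(ts ∷ʳ t) (ts ∶ r ∶ʳ t) vs with v ∷ [] ← All.++⁻ʳ ts vs with jOf t ℕ.≤? n
... | yes l = shortSplit-∷ʳ-small ts (shortSplit ts r (All.++⁻ˡ ts vs)) t v l
... | no ¬l = shortSplit-∷ʳ-large ts (shortSplit ts r (All.++⁻ˡ ts vs)) t v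
                (ℕ.≤-antisym (Ends.hi≤ (ends v)) (ℕ.≰⇒> ¬l))

product⇒code : ∀ n ts → All (ValidRefl n) ts →
               ∃ λ (c : Code n) → (∀ z → prodApply ts z ≡ Φ c z) × ℓ c ≤ length ts
product⇒code zero ts vs with refl ← valid-zero vs = ε , (λ _ → refl) , z≤n
product⇒code (suc n) ts vs = extend (product⇒code n init valid)
  where
  open ShortSplit (shortSplit ts (reverseView ts) vs)
  extend : (∃ λ (c : Code n) → (∀ z → prodApply init z ≡ Φ c z) × ℓ c ≤ length init) →
           ∃ λ (c : Code (suc n)) → (∀ z → prodApply ts z ≡ Φ c z) × ℓ c ≤ length ts
  extend (c , e , l) = snoc c x x∈ , (λ z → trans (product z) (e _)) , ℕ.≤-trans (ℕ.+-monoˡ-≤ _ l) length≤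

φ-IsReflLength : ∀ {n} (c : Code n) → IsReflLength n (φ c) (ℓ c)
φ-IsReflLength {n} c =
  (factors , (valid , λ i p q → trans (product (+ i)) (sym (φ-! c i (p , q)))) , length≡) , minimal
  where
  open Factorization (factorization c)
  minimal : ∀ ts → IsProduct n ts (φ c) → ℓ c ≤ length ts
  minimal ts (vs , h) with d , e , l ← product⇒code n ts vs with refl ← product-code-unique c d {ts} e h = l

-- The bijection

toList-IsSE : ∀ {n} (c : Code n) → IsSE n (toList c)
toList-IsSE c = length-toList c , entries c
  where
  nonzero : ∀ {x} → 1 ≤ ∣ x ∣ → x ≢ + 0
  nonzero () refl
  entries : ∀ {n} (c : Code n) i → 1 ≤ i → i ≤ n → toList c ! i ≢ + 0 × ∣ toList c ! i ∣ ≤ i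
  entries ε i p q = contradiction (ℕ.≤-trans p q) ℕ.1+n≰n
  entries (snoc c x r) i p q with ℕ.m≤n⇒m<n∨m≡n q
  ... | inj₁ (s≤s i≤n) rewrite toList-!-init c x r i (p , i≤n) = entries c i p i≤n
  ... | inj₂ refl      rewrite toList-!-last c x r = nonzero (proj₁ r) , proj₂ r

IsSE⇒toList : ∀ {n} w → Reverse w → IsSE n w → ∃ λ (c : Code n) → toList c ≡ w
IsSE⇒toList .[] [] (refl , _) = ε , refl
IsSE⇒toList {n} .(w ∷ʳ x) (w ∶ r ∶ʳ x) (len , h) with refl ← trans (sym len) (length-∷ʳ w x)
  with last≢0 , last≤ ← h (suc (length w)) (s≤s z≤n) ℕ.≤-refl
  with c , e ← IsSE⇒toList w r (refl , λ i p q →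
         subst (λ y → y ≢ + 0 × ∣ y ∣ ≤ i) (∷ʳ-!-init w x i (p , q)) (h i p (ℕ.m≤n⇒m≤1+n q))) =
  snoc c x (positive x (last≢0 ∘ trans (∷ʳ-!-last w x)) , subst (λ y → ∣ y ∣ ≤ suc (length w)) (∷ʳ-!-last w x) last≤)
  , cong (_∷ʳ x) e
  where
  positive : ∀ x → x ≢ + 0 → 1 ≤ ∣ x ∣
  positive (+ zero)  ne = contradiction refl ne
  positive (+ suc _) _  = s≤s z≤n
  positive -[1+ _ ]  _  = s≤s z≤n

-- `Φ` on raw words, since the map `ψ` must be defined on every word. A list is consumed from the
-- left whereas a `Code` is consumed from the right, so the index of the current factor is carried
-- in `j`.
swapsFrom : ℕ → Word → ℤ → ℤ
swapsFrom j []      z = z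
swapsFrom j (x ∷ c) z = swap x (+ j) (swapsFrom (suc j) c z)

decode : Word → Word
decode c = map (λ i → swapsFrom 1 c (+ i)) (range1 (length c))

swapsFrom-∷ʳ : ∀ j c x z → swapsFrom j (c ∷ʳ x) z ≡ swapsFrom j c (swap x (+ (length c ℕ.+ j)) z)
swapsFrom-∷ʳ j []      x z = refl
swapsFrom-∷ʳ j (y ∷ c) x z = cong (swap y (+ j)) (trans (swapsFrom-∷ʳ (suc j) c x z)
  (cong (λ m → swapsFrom (suc j) c (swap x (+ m) z)) (ℕ.+-suc (length c) j)))

swapsFrom-toList : ∀ {n} (c : Code n) z → swapsFrom 1 (toList c) z ≡ Φ c z
swapsFrom-toList ε z = refl
swapsFrom-toList {suc n} (snoc c x r) z = begin
  swapsFrom 1 (toList c ∷ʳ x) z                                  ≡⟨ swapsFrom-∷ʳ 1 (toList c) x z ⟩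
  swapsFrom 1 (toList c) (swap x (+ (length (toList c) ℕ.+ 1)) z) ≡⟨ cong (λ m → swapsFrom 1 (toList c) (swap x (+ m) z))
                                                                      (trans (ℕ.+-comm _ 1) (cong suc (length-toList c))) ⟩
  swapsFrom 1 (toList c) (swap x (+ suc n) z)                    ≡⟨ swapsFrom-toList c _ ⟩
  Φ c (swap x (+ suc n) z)                                       ∎
  where open ≡-Reasoning

decode-toList : ∀ {n} (c : Code n) → decode (toList c) ≡ φ c
decode-toList {n} c = trans (cong (map (λ i → swapsFrom 1 (toList c) (+ i)) ∘ range1) (length-toList c))
  (range1-map-cong n (λ i _ → swapsFrom-toList c (+ i)))

ψ : Word → Word
ψ σ = decode (Acode σ)

ψ-α : ∀ {n} (c : Code n) → ψ (α c) ≡ φ c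
ψ-α c = trans (cong decode (Acode-α c)) (decode-toList c)

φ-injective : ∀ {n} (c d : Code n) → φ c ≡ φ d → c ≡ d
φ-injective c d e = toList-injective c d (trans (sym (Bcode-φ c)) (trans (cong Bcode e) (Bcode-φ d)))

theorem3p7 : (n : ℕ) → 1 ≤ n →
    ( (∀ w → IsB n w → IsSE n (Bcode w))
    × (∀ v w → IsB n v → IsB n w → Bcode v ≡ Bcode w → v ≡ w)
    × (∀ c → IsSE n c → Σ Word (λ w → IsB n w × Bcode w ≡ c)) )
    × Σ (Word → Word) (λ ψ →
    (∀ σ → IsB n σ → IsB n (ψ σ) × Bcode (ψ σ) ≡ Acode σ)
    × (∀ σ τ → IsB n σ → IsB n τ → ψ σ ≡ ψ τ → σ ≡ τ)
    × (∀ τ → IsB n τ → Σ Word (λ σ → IsB n σ × ψ σ ≡ τ))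
    × (∀ σ → IsB n σ →
    IsSorB n (ψ σ) (invB σ)
    × Lmap σ ≡ Lmap (ψ σ)
    × Rmil σ ≡ CycB (ψ σ)
    × IsReflLength n (ψ σ) (nmin σ)))
theorem3p7 n _ = (Bcode-IsSE , Bcode-injective , Bcode-surjective) ,
                 ψ , Bcode-ψ , ψ-injective , ψ-surjective , statistics
  where
  Bcode-IsSE : ∀ w → IsB n w → IsSE n (Bcode w)
  Bcode-IsSE w b with c , refl ← IsB⇒φ b = subst (IsSE n) (sym (Bcode-φ c)) (toList-IsSE c)

  Bcode-injective : ∀ v w → IsB n v → IsB n w → Bcode v ≡ Bcode w → v ≡ w
  Bcode-injective v w bv bw e with c , refl ← IsB⇒φ bv | d , refl ← IsB⇒φ bw =
    cong φ (toList-injective c d (trans (sym (Bcode-φ c)) (trans e (Bcode-φ d))))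

  Bcode-surjective : ∀ c → IsSE n c → Σ Word (λ w → IsB n w × Bcode w ≡ c)
  Bcode-surjective c se with d , refl ← IsSE⇒toList c (reverseView c) se = φ d , φ-IsB d , Bcode-φ d

  Bcode-ψ : ∀ σ → IsB n σ → IsB n (ψ σ) × Bcode (ψ σ) ≡ Acode σ
  Bcode-ψ σ b with c , refl ← IsB⇒α b rewrite ψ-α c = φ-IsB c , trans (Bcode-φ c) (sym (Acode-α c))

  ψ-injective : ∀ σ τ → IsB n σ → IsB n τ → ψ σ ≡ ψ τ → σ ≡ τ
  ψ-injective σ τ bσ bτ e with c , refl ← IsB⇒α bσ | d , refl ← IsB⇒α bτ =
    cong α (φ-injective c d (trans (sym (ψ-α c)) (trans e (ψ-α d))))

  ψ-surjective : ∀ τ → IsB n τ → Σ Word (λ σ → IsB n σ × ψ σ ≡ τ)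
  ψ-surjective τ b with c , refl ← IsB⇒φ b = α c , α-IsB c , ψ-α c

  statistics : ∀ σ → IsB n σ → IsSorB n (ψ σ) (invB σ) × Lmap σ ≡ Lmap (ψ σ) × Rmil σ ≡ CycB (ψ σ)
                             × IsReflLength n (ψ σ) (nmin σ)
  statistics σ b with c , refl ← IsB⇒α b rewrite ψ-α c =
      subst (IsSorB n (φ c)) (sym (invB-α c)) (φ-IsSorB c)
    , Lmap-α-φ c
    , Rmil-α-CycB-φ c
    , subst (IsReflLength n (φ c)) (sym (nmin-α c)) (φ-IsReflLength c)
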